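{- Let $G$ be a finite group, $H$ a subgroup of $G$, $\mathcal{D}$ an admissible set of subgroups of $G$, and $p$ a prime divisor of $(G:H)$. Let $\mathcal{D}_{(H)}:=\mathcal{C}_{H}\cup(\mathcal{D}\setminus\mathcal{C}_{G})$ and let $\mathcal{D}_{(H,p)}$ be the set of $p$-Sylow subgroups of all elements of $\mathcal{D}_{(H)}$. Then $\operatorname{Sha}_{\mathcal{D}}^{2}(G,J_{G/H})[p^{\infty}]=\operatorname{Sha}_{\mathcal{D}_{(H,p)}}^{2}(G,J_{G/H})[p^{\infty}]$. In particular, $\operatorname{Sha}_{\omega}^{2}(G,J_{G/H})[p^{\infty}]=\operatorname{Sha}_{\mathcal{C}_{H,p}}^{2}(G,J_{G/H})[p^{\infty}]$, where $\mathcal{C}_{H,p}$ is the set of all cyclic subgroups of $H$ of $p$-power order.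
   Context: $\mathcal{C}_G$ (resp. $\mathcal{C}_H$) is the set of cyclic subgroups of $G$ (resp. $H$). $J_{G/H}$ is the cokernel of $\mathbb{Z}\to\operatorname{Ind}_H^G\mathbb{Z}=\mathrm{Hom}_{\mathbb{Z}[H]}(\mathbb{Z}[G],\mathbb{Z})$, $1\mapsto$ constant function $1$. $\operatorname{Sha}^2_{\mathcal{D}}(G,M):=\ker\big(H^2(G,M)\to\bigoplus_{D\in\mathcal{D}}H^2(D,M)\big)$; $\operatorname{Sha}^2_\omega$ is the case $\mathcal{D}=\mathcal{C}_G$. A finite set of subgroups is admissible if it contains all cyclic subgroups and is stable under conjugation. $A[p^\infty]$ is the $p$-primary torsion part. -}

module Defs where

open import Data.Nat as ℕ using (ℕ; zero; suc; _^_)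
open import Data.Nat.Divisibility using (_∣_)
open import Data.Integer as ℤ using (ℤ)
open import Data.Fin using (Fin)
open import Data.Fin.Subset using (Subset; _∈_; _⊆_; ∣_∣)
open import Data.Vec using (tabulate; lookup)
open import Data.Product using (Σ; _×_; ∃)
open import Data.Sum using (_⊎_)
open import Relation.Nullary using (¬_)
open import Relation.Binary.PropositionalEquality using (_≡_)

record FinGroup : Set where
  field
    order : ℕ
    _·_   : Fin order → Fin order → Fin order
    e     : Fin order
    inv   : Fin order → Fin order
    assoc : ∀ x y z → (x · y) · z ≡ x · (y · z)
    idˡ   : ∀ x → e · x ≡ x
    idʳ   : ∀ x → x · e ≡ x
    invˡ  : ∀ x → inv x · x ≡ e
    invʳ  : ∀ x → x · inv x ≡ e

module _ (G : FinGroup) where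
  open FinGroup G

  El : Set
  El = Fin order

  -- subsets of G (canonical representation, so ≡ is equality of subsets)
  Sub : Set
  Sub = Subset order

  IsSubgroup : Sub → Set
  IsSubgroup S = (e ∈ S) × (∀ x y → x ∈ S → y ∈ S → (x · y) ∈ S)
                 × (∀ x → x ∈ S → inv x ∈ S)

  pow : El → ℕ → El
  pow g zero    = e
  pow g (suc k) = g · pow g k

  IsCyclicSubgroup : Sub → Set
  IsCyclicSubgroup S = ∃ λ g → (∀ x → x ∈ S → ∃ λ k → x ≡ pow g k)
                               × (∀ k → pow g k ∈ S)

  conj : El → Sub → Sub
  conj g S = tabulate (λ x → lookup S ((inv g · x) · g))

  -- a set of subgroups of G (automatically finite, as there are finitely many subsets)
  SetOfSubgroups : Set₁
  SetOfSubgroups = Sub → Set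

  IsAdmissible : SetOfSubgroups → Set
  IsAdmissible 𝒟 = (∀ S → 𝒟 S → IsSubgroup S)
                 × (∀ S → IsCyclicSubgroup S → 𝒟 S)
                 × (∀ g S → 𝒟 S → 𝒟 (conj g S))

  IsIndex : Sub → ℕ → Set
  IsIndex H m = ∣ H ∣ ℕ.* m ≡ order

  IsSylow : ℕ → Sub → Sub → Set
  IsSylow p S P = IsSubgroup P × P ⊆ S ×
    (∃ λ k → (∣ P ∣ ≡ p ^ k) × (p ^ k ∣ ∣ S ∣) × ¬ (p ^ suc k ∣ ∣ S ∣))

  𝒟H : SetOfSubgroups → Sub → SetOfSubgroups
  𝒟H 𝒟 H S = (IsCyclicSubgroup S × S ⊆ H) ⊎ (𝒟 S × ¬ IsCyclicSubgroup S)

  𝒟Hp : SetOfSubgroups → Sub → ℕ → SetOfSubgroups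
  𝒟Hp 𝒟 H p P = ∃ λ S → 𝒟H 𝒟 H S × IsSylow p S P

  𝒞 : SetOfSubgroups
  𝒞 S = IsCyclicSubgroup S

  𝒞Hp : Sub → ℕ → SetOfSubgroups
  𝒞Hp H p S = IsCyclicSubgroup S × S ⊆ H × ∃ λ k → ∣ S ∣ ≡ p ^ k

  -- The module J_{G/H}.  Ind_H^G ℤ = Hom_{ℤ[H]}(ℤ[G], ℤ) is realised as
  -- functions φ : G → ℤ with φ(h x) = φ(x) for h ∈ H, with G-action
  -- (g·φ)(x) = φ(x g).  J_{G/H} is its quotient by the constants; we work
  -- with representatives and the relation "differ by a constant".

  IndFun : Set
  IndFun = El → ℤ

  IsHInv : Sub → IndFun → Set
  IsHInv H φ = ∀ h x → h ∈ H → φ (h · x) ≡ φ x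

  act : El → IndFun → IndFun
  act g φ x = φ (x · g)

  _≈J_ : IndFun → IndFun → Set
  φ ≈J ψ = ∃ λ c → ∀ x → φ x ≡ ψ x ℤ.+ c

  Cochain1 : Set
  Cochain1 = El → IndFun

  Cochain2 : Set
  Cochain2 = El → El → IndFun

  IsHInv1 : Sub → Cochain1 → Set
  IsHInv1 H c = ∀ g → IsHInv H (c g)

  IsHInv2 : Sub → Cochain2 → Set
  IsHInv2 H f = ∀ g k → IsHInv H (f g k)

  IsCocycle2 : Cochain2 → Set
  IsCocycle2 f = ∀ g h k →
    (λ x → ((act g (f h k) x ℤ.- f (g · h) k x) ℤ.+ f g (h · k) x) ℤ.- f g h x)
      ≈J (λ _ → ℤ.0ℤ)

  IsCoboundaryOn : Sub → Sub → Cochain2 → Set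
  IsCoboundaryOn H S f = Σ Cochain1 λ c → IsHInv1 H c ×
    (∀ g h → g ∈ S → h ∈ S →
      f g h ≈J (λ x → (act g (c h) x ℤ.- c (g · h) x) ℤ.+ c g x))

  full : Sub
  full = tabulate (λ _ → Data.Fin.Subset.inside)

  scale : ℕ → Cochain2 → Cochain2
  scale m f g h x = ℤ.+ m ℤ.* f g h x

  IsPPrimaryCocycle : Sub → ℕ → Cochain2 → Set
  IsPPrimaryCocycle H p f = IsHInv2 H f × IsCocycle2 f
    × ∃ λ k → IsCoboundaryOn H full (scale (p ^ k) f)

  InSha : Sub → SetOfSubgroups → Cochain2 → Set
  InSha H 𝒟 f = ∀ S → 𝒟 S → IsCoboundaryOn H S f

{-# OPTIONS --safe #-}
module Submission where

open import Defs
open import Algebra.Bundles using (Group)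
import Algebra.Properties.Group as GroupProperties
import Data.Bool.Properties as Boolₚ
open import Data.Empty using (⊥-elim)
open import Data.Fin using (Fin; zero; suc; toℕ; fromℕ<)
import Data.Fin.Properties as Finₚ
open import Data.Fin.Subset using (Subset; _∈_; _⊆_; ∣_∣; inside; outside)
open import Data.Fin.Subset.Properties using (_∈?_; ⊆-antisym; drop-there; drop-∷-⊆; p⊆q⇒∣p∣≤∣q∣)
open import Data.Integer as ℤ using (ℤ; +_; -_; _+_; _*_; _-_; 0ℤ; 1ℤ)
import Data.Integer.Divisibility.Signed as ℤ∣
import Data.Integer.Properties as ℤₚ
open import Data.Integer.Tactic.RingSolver using (solve-∀)
open import Data.List using (List; []; _∷_; _++_; map; filter; length; allFin; upTo)
import Data.List.Extrema
open import Data.List.Membership.Propositional using (find; lose) renaming (_∈_ to _∈ₗ_)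
import Data.List.Membership.Propositional.Properties as ∈ₗ
import Data.List.Properties as Listₚ
import Data.List.Relation.Unary.All as All
open import Data.List.Relation.Unary.AllPairs using ([]; _∷_)
import Data.List.Relation.Unary.Any as Any
open import Data.List.Relation.Unary.Any using (here; there)
open import Data.List.Relation.Unary.Unique.Propositional using (Unique)
import Data.List.Relation.Unary.Unique.Propositional.Properties as Uniqueₚ
open import Data.Nat as ℕ using (ℕ; zero; suc; _^_; s≤s)
open import Data.Nat.Coprimality as Coprimality using (Coprime)
open import Data.Nat.DivMod using (_%_; _/_; m≡m%n+[m/n]*n; m%n<n)
open import Data.Nat.Divisibility as ℕ∣ using (_∣_; divides)
import Data.Nat.GCD as GCD
open import Data.Nat.Induction using (<-wellFounded)
open import Data.Nat.Primality using (Prime; prime⇒irreducible; prime⇒nonTrivial; prime⇒nonZero; ¬prime[1])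
import Data.Nat.Properties as ℕₚ
open import Data.Product using (Σ; _×_; ∃; _,_; proj₁; proj₂)
open import Data.Sum using (inj₁; inj₂)
open import Data.Vec using ([]; _∷_; tabulate; here; there)
import Data.Vec.Properties as Vecₚ
open import Function using (id)
open import Function.Bundles using (_⇔_; mk⇔)
open import Induction.WellFounded using (Acc; acc)
open import Level using (0ℓ)
open import Relation.Binary.Definitions using (DecidableEquality)
open import Relation.Binary.PropositionalEquality using (_≡_; _≢_; refl; sym; trans; cong; cong₂; subst; isEquivalence; module ≡-Reasoning)
open import Relation.Nullary using (¬_; Dec; yes; no; does)
open import Relation.Nullary.Decidable using (¬?; _×-dec_; _→-dec_; decidable-stable; map′)

-- Write J = Ind/ℤ and use F(a,b,c) = a·f(a⁻¹b, b⁻¹c).  If f is a coboundary on a subgroup P, then F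
-- is the coboundary of a P-equivariant 1-cochain defined on all of G; this makes conjugation
-- invariance and the transfer from P to S explicit.
--
-- Let f be p-primary and S ∈ 𝒟.  If S is not cyclic, its p-Sylow subgroup P lies in 𝒟_(H,p), so
-- [S:P] f is a coboundary on S by transfer, and p^k f is one too; [S:P] is prime to p.
--
-- If S = ⟨g⟩ has order n, let E = Σ_{i<n} f(gⁱ, g), a function on H\G/S.  Then f is a coboundary on
-- S iff E = T + N b for a constant T and some b, that is, iff E(x) ≡ T mod s(x) for all x, where
-- s(x) = |S ∩ x⁻¹Hx|.  Choose x₀ with p^r = p-part of s(x₀) maximal.  The subgroup of order p^r of S
-- is conjugate (by x₀) to a cyclic p-subgroup of H, where f is a coboundary by hypothesis; this
-- gives E(x) ≡ T modulo the p-part of s(x) for every x.  So m f is a coboundary on S, m being the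
-- prime-to-p part of n, and again so is p^k f.

-- Integers

-- The obstacle is the quotient by constants. On one double coset H x S the congruence E(x) ≡ T mod
-- s(x) can always be met by a choice of T; f becomes a coboundary on S only if a single T serves
-- all double cosets. Splitting f on the subgroups of H one at a time gives a constant for each of
-- them, with no relation between these constants. This is what the maximality of x₀ is for: the
-- p-subgroups of the cyclic group S form a chain, so the one of order p^r contains the p-Sylow
-- subgroup of every S ∩ x⁻¹Hx, and the constant it provides works at every x. Passing to it keeps
-- the function E and only replaces the norm of S by that of the smaller group. Transfer is of no
-- help for such S: the p-Sylow subgroup of S can be larger than p^r, and then it has no conjugate
-- inside H. Equality in J is equality of functions up to a constant, so nearly every identity below
-- carries an explicit constant κ, which has to be independent of the point x.

i-j≡0 : ∀ {i j : ℤ} → i ≡ j → i - j ≡ 0ℤ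
i-j≡0 {i} refl = ℤₚ.+-inverseʳ i

-- Linear consequences of equations are derived this way throughout: the solver writes the
-- difference of the goal as a combination of the differences of the hypotheses, which vanish by
-- `i-j≡0`.
≡-from-difference : ∀ {i j d : ℤ} → i - j ≡ d → d ≡ 0ℤ → i ≡ j
≡-from-difference {i} {j} p q = ℤₚ.i-j≡0⇒i≡j i j (trans p q)

⟦_⟧ : ∀ {ℓ} {A : Set ℓ} → Dec A → ℤ
⟦ yes _ ⟧ = 1ℤ
⟦ no  _ ⟧ = 0ℤ

module _ {ℓ ℓ′} {A : Set ℓ} {B : Set ℓ′} where

  ⟦⟧*-cong : (a : Dec A) (b : Dec B) → (A → B) → (B → A) →
             ∀ {i j} → (A → i ≡ j) → ⟦ a ⟧ * i ≡ ⟦ b ⟧ * j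
  ⟦⟧*-cong (yes a) (yes b) f g eq = cong (1ℤ *_) (eq a)
  ⟦⟧*-cong (yes a) (no ¬b) f g eq = ⊥-elim (¬b (f a))
  ⟦⟧*-cong (no ¬a) (yes b) f g eq = ⊥-elim (¬a (g b))
  ⟦⟧*-cong (no ¬a) (no ¬b) f g eq = refl

  ⟦⟧-cong : (a : Dec A) (b : Dec B) → (A → B) → (B → A) → ⟦ a ⟧ ≡ ⟦ b ⟧
  ⟦⟧-cong (yes a) (yes b) f g = refl
  ⟦⟧-cong (yes a) (no ¬b) f g = ⊥-elim (¬b (f a))
  ⟦⟧-cong (no ¬a) (yes b) f g = ⊥-elim (¬a (g b))
  ⟦⟧-cong (no ¬a) (no ¬b) f g = refl

⟦⟧-true : ∀ {ℓ} {A : Set ℓ} (a : Dec A) → A → ⟦ a ⟧ ≡ 1ℤ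
⟦⟧-true (yes _) a = refl
⟦⟧-true (no ¬a) a = ⊥-elim (¬a a)

⟦⟧-false : ∀ {ℓ} {A : Set ℓ} (a : Dec A) → ¬ A → ⟦ a ⟧ ≡ 0ℤ
⟦⟧-false (yes a) ¬a = ⊥-elim (¬a a)
⟦⟧-false (no _)  ¬a = refl

-- Sums over lists

∑ : ∀ {ℓ} {A : Set ℓ} → List A → (A → ℤ) → ℤ
∑ []       φ = 0ℤ
∑ (x ∷ xs) φ = φ x + ∑ xs φ

module _ {ℓ} {A : Set ℓ} where

  ∑-cong-∈ : ∀ (xs : List A) {φ ψ : A → ℤ} → (∀ x → x ∈ₗ xs → φ x ≡ ψ x) → ∑ xs φ ≡ ∑ xs ψ
  ∑-cong-∈ []       eq = refl
  ∑-cong-∈ (x ∷ xs) eq = cong₂ _+_ (eq x (here refl)) (∑-cong-∈ xs (λ y y∈ → eq y (there y∈)))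

  ∑-cong : ∀ (xs : List A) {φ ψ : A → ℤ} → (∀ x → φ x ≡ ψ x) → ∑ xs φ ≡ ∑ xs ψ
  ∑-cong xs eq = ∑-cong-∈ xs (λ x _ → eq x)

  ∑-zero : ∀ (xs : List A) → ∑ xs (λ _ → 0ℤ) ≡ 0ℤ
  ∑-zero []       = refl
  ∑-zero (x ∷ xs) = trans (ℤₚ.+-identityˡ _) (∑-zero xs)

  ∑-+ : ∀ (xs : List A) (φ ψ : A → ℤ) → ∑ xs (λ x → φ x + ψ x) ≡ ∑ xs φ + ∑ xs ψ
  ∑-+ []       φ ψ = refl
  ∑-+ (x ∷ xs) φ ψ = trans (cong (_+_ ((φ x + ψ x))) (∑-+ xs φ ψ)) (lemma (φ x) (ψ x) _ _)
    where
    lemma : ∀ a b c d → (a + b) + (c + d) ≡ (a + c) + (b + d)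
    lemma = solve-∀

  ∑-*ˡ : ∀ (xs : List A) (k : ℤ) (φ : A → ℤ) → ∑ xs (λ x → k * φ x) ≡ k * ∑ xs φ
  ∑-*ˡ []       k φ = sym (ℤₚ.*-zeroʳ k)
  ∑-*ˡ (x ∷ xs) k φ = trans (cong (_+_ (k * φ x)) (∑-*ˡ xs k φ)) (sym (ℤₚ.*-distribˡ-+ k _ _))

  ∑-*ʳ : ∀ (xs : List A) (k : ℤ) (φ : A → ℤ) → ∑ xs (λ x → φ x * k) ≡ ∑ xs φ * k
  ∑-*ʳ xs k φ = trans (∑-cong xs (λ x → ℤₚ.*-comm (φ x) k)) (trans (∑-*ˡ xs k φ) (ℤₚ.*-comm k _))

  ∑-neg : ∀ (xs : List A) (φ : A → ℤ) → ∑ xs (λ x → - φ x) ≡ - ∑ xs φ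
  ∑-neg []       φ = refl
  ∑-neg (x ∷ xs) φ = trans (cong (_+_ (- φ x)) (∑-neg xs φ)) (sym (ℤₚ.neg-distrib-+ (φ x) _))

  ∑-− : ∀ (xs : List A) (φ ψ : A → ℤ) → ∑ xs (λ x → φ x - ψ x) ≡ ∑ xs φ - ∑ xs ψ
  ∑-− xs φ ψ = trans (∑-+ xs φ (λ x → - ψ x)) (cong (_+_ (∑ xs φ)) (∑-neg xs ψ))

  ∑-length : ∀ (xs : List A) → ∑ xs (λ _ → 1ℤ) ≡ + length xs
  ∑-length []       = refl
  ∑-length (x ∷ xs) = cong (_+_ (1ℤ)) (∑-length xs)

  ∑-filter : ∀ {p} {P : A → Set p} (P? : ∀ x → Dec (P x)) (xs : List A) (φ : A → ℤ) →
             ∑ (filter P? xs) φ ≡ ∑ xs (λ x → ⟦ P? x ⟧ * φ x)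
  ∑-filter P? []       φ = refl
  ∑-filter P? (x ∷ xs) φ with P? x
  ... | yes _ = cong₂ _+_ (sym (ℤₚ.*-identityˡ (φ x))) (∑-filter P? xs φ)
  ... | no _  = trans (∑-filter P? xs φ) (sym (ℤₚ.+-identityˡ _))

  -- Read from right to left, this inserts a sum over fibres; together with `∑-swap` it is the means
  -- of regrouping sums in all the counting arguments below.
  ∑-δ : (_≟_ : DecidableEquality A) → ∀ {xs : List A} → Unique xs → ∀ {a} → a ∈ₗ xs →
        (φ : A → ℤ) → ∑ xs (λ x → ⟦ a ≟ x ⟧ * φ x) ≡ φ a
  ∑-δ _≟_ {a ∷ xs} (a∉ ∷ _) (here refl) φ =
    trans (cong₂ _+_ (cong (_* φ a) (⟦⟧-true (a ≟ a) refl))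
                     (trans (∑-cong-∈ xs (λ x x∈ → cong (_* φ x) (⟦⟧-false (a ≟ x) (All.lookup a∉ x∈))))
                            (∑-zero xs)))
          (lemma (φ a))
    where
    lemma : ∀ v → 1ℤ * v + 0ℤ ≡ v
    lemma = solve-∀
  ∑-δ _≟_ {x ∷ xs} (x∉ ∷ u) {a} (there a∈) φ =
    trans (cong₂ _+_ (cong (_* φ x) (⟦⟧-false (a ≟ x) (λ a≡x → All.lookup x∉ a∈ (sym a≡x))))
                     (∑-δ _≟_ u a∈ φ))
          (ℤₚ.+-identityˡ _)

∑-swap : ∀ {ℓ ℓ′} {A : Set ℓ} {B : Set ℓ′} (xs : List A) (ys : List B) (φ : A → B → ℤ) →
         ∑ xs (λ x → ∑ ys (φ x)) ≡ ∑ ys (λ y → ∑ xs (λ x → φ x y))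
∑-swap []       ys φ = sym (∑-zero ys)
∑-swap (x ∷ xs) ys φ = trans (cong (_+_ (∑ ys (φ x))) (∑-swap xs ys φ)) (sym (∑-+ ys (φ x) (λ y → ∑ xs (λ x → φ x y))))

-- Remove the class of the first element: what remains is shorter, since that element leaves, and
-- the classes of the remaining elements keep their sizes.
∣-classes : ∀ {ℓ r} {A : Set ℓ} {_∼_ : A → A → Set r} (_∼?_ : ∀ x y → Dec (x ∼ y)) →
            (∀ {x} → x ∼ x) → (∀ {x y} → x ∼ y → y ∼ x) → (∀ {x y z} → x ∼ y → y ∼ z → x ∼ z) →
            ∀ (d : ℤ) (xs : List A) → (∀ x → x ∈ₗ xs → d ℤ∣.∣ ∑ xs (λ y → ⟦ x ∼? y ⟧)) →
            d ℤ∣.∣ ∑ xs (λ _ → 1ℤ)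
∣-classes {A = A} {_∼_} _∼?_ ∼refl ∼sym ∼trans d xs₀ = go xs₀ (<-wellFounded (length xs₀))
  where
  go : ∀ xs → Acc ℕ._<_ (length xs) → (∀ x → x ∈ₗ xs → d ℤ∣.∣ ∑ xs (λ y → ⟦ x ∼? y ⟧)) →
       d ℤ∣.∣ ∑ xs (λ _ → 1ℤ)
  go []       _         h = ℤ∣.divides 0ℤ refl
  go (x ∷ xs) (acc rec) h = subst (d ℤ∣.∣_) (sym split)
    (ℤ∣.∣m∣n⇒∣m+n (h x (here refl)) (go rest (rec shorter) h′))
    where
    P? = λ y → ¬? (x ∼? y)
    rest = filter P? (x ∷ xs)
    shorter : length rest ℕ.< length (x ∷ xs)
    shorter with x ∼? x
    ... | yes _ = s≤s (Listₚ.length-filter P? xs)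
    ... | no ¬x = ⊥-elim (¬x ∼refl)
    case : ∀ y → 1ℤ ≡ ⟦ x ∼? y ⟧ + ⟦ P? y ⟧ * 1ℤ
    case y with x ∼? y
    ... | yes _ = refl
    ... | no _  = refl
    split : ∑ (x ∷ xs) (λ _ → 1ℤ) ≡ ∑ (x ∷ xs) (λ y → ⟦ x ∼? y ⟧) + ∑ rest (λ _ → 1ℤ)
    split = trans (∑-cong (x ∷ xs) case)
            (trans (∑-+ (x ∷ xs) (λ y → ⟦ x ∼? y ⟧) (λ y → ⟦ P? y ⟧ * 1ℤ))
                   (cong (_+_ (∑ (x ∷ xs) (λ y → ⟦ x ∼? y ⟧))) (sym (∑-filter P? (x ∷ xs) (λ _ → 1ℤ)))))
    same : ∀ y → ¬ (x ∼ y) → ∀ z → ⟦ P? z ⟧ * ⟦ y ∼? z ⟧ ≡ ⟦ y ∼? z ⟧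
    same y x≁y z with x ∼? z | y ∼? z
    ... | yes x∼z | yes y∼z = ⊥-elim (x≁y (∼trans x∼z (∼sym y∼z)))
    ... | yes x∼z | no _    = refl
    ... | no _    | yes _   = refl
    ... | no _    | no _    = refl
    h′ : ∀ y → y ∈ₗ rest → d ℤ∣.∣ ∑ rest (λ z → ⟦ y ∼? z ⟧)
    h′ y y∈ with ∈ₗ.∈-filter⁻ P? {xs = x ∷ xs} y∈
    ... | y∈xs , x≁y = subst (d ℤ∣.∣_)
      (sym (trans (∑-filter P? (x ∷ xs) (λ z → ⟦ y ∼? z ⟧)) (∑-cong (x ∷ xs) (same y x≁y)))) (h y y∈xs)

-- Sums over initial segments of ℕ

∑< : ℕ → (ℕ → ℤ) → ℤ
∑< zero    φ = 0ℤ
∑< (suc n) φ = ∑< n φ + φ n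

∑<-cong : ∀ n {φ ψ : ℕ → ℤ} → (∀ i → φ i ≡ ψ i) → ∑< n φ ≡ ∑< n ψ
∑<-cong zero    eq = refl
∑<-cong (suc n) eq = cong₂ _+_ (∑<-cong n eq) (eq n)

∑<-*ˡ : ∀ n (k : ℤ) (φ : ℕ → ℤ) → ∑< n (λ i → k * φ i) ≡ k * ∑< n φ
∑<-*ˡ zero    k φ = sym (ℤₚ.*-zeroʳ k)
∑<-*ˡ (suc n) k φ = trans (cong (_+ k * φ n) (∑<-*ˡ n k φ)) (sym (ℤₚ.*-distribˡ-+ k _ _))

∑<-split : ∀ m n (φ : ℕ → ℤ) → ∑< (m ℕ.+ n) φ ≡ ∑< m φ + ∑< n (λ i → φ (m ℕ.+ i))
∑<-split m zero    φ = trans (cong (λ k → ∑< k φ) (ℕₚ.+-identityʳ m)) (sym (ℤₚ.+-identityʳ _))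
∑<-split m (suc n) φ = trans (cong (λ k → ∑< k φ) (ℕₚ.+-suc m n))
  (trans (cong (_+ φ (m ℕ.+ n)) (∑<-split m n φ)) (ℤₚ.+-assoc (∑< m φ) _ _))

∑<-periodic : ∀ k d (φ : ℕ → ℤ) → (∀ i → φ (d ℕ.+ i) ≡ φ i) → ∑< (k ℕ.* d) φ ≡ + k * ∑< d φ
∑<-periodic zero    d φ per = refl
∑<-periodic (suc k) d φ per = trans (∑<-split d (k ℕ.* d) φ)
  (trans (cong (_+_ (∑< d φ)) (trans (∑<-cong (k ℕ.* d) per) (∑<-periodic k d φ per)))
         (trans (lemma (∑< d φ) (+ k)) (cong (_* ∑< d φ) (sym (ℤₚ.pos-+ 1 k)))))
  where
  lemma : ∀ a b → a + b * a ≡ (1ℤ + b) * a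
  lemma = solve-∀

∑<-zero : ∀ n (φ : ℕ → ℤ) → (∀ i → i ℕ.< n → φ i ≡ 0ℤ) → ∑< n φ ≡ 0ℤ
∑<-zero zero    φ z = refl
∑<-zero (suc n) φ z = cong₂ _+_ (∑<-zero n φ (λ i i<n → z i (ℕₚ.m<n⇒m<1+n i<n))) (z n ℕₚ.≤-refl)

∑<-single : ∀ n (φ : ℕ → ℤ) i → i ℕ.< n → (∀ j → j ℕ.< n → j ≢ i → φ j ≡ 0ℤ) → ∑< n φ ≡ φ i
∑<-single (suc n) φ i i<1+n z with i ℕ.≟ n
... | yes refl = trans (cong (_+ φ n) (∑<-zero n φ (λ j j<n → z j (ℕₚ.m<n⇒m<1+n j<n) (ℕₚ.<⇒≢ j<n)))) (ℤₚ.+-identityˡ _)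
... | no i≢n = trans (cong₂ _+_ (∑<-single n φ i (ℕₚ.≤∧≢⇒< (ℕₚ.≤-pred i<1+n) i≢n) (λ j j<n → z j (ℕₚ.m<n⇒m<1+n j<n)))
                                (z n ℕₚ.≤-refl (λ n≡i → i≢n (sym n≡i)))) (ℤₚ.+-identityʳ _)

-- Primes

prime∤⇒coprime : ∀ {p m} → Prime p → ¬ p ∣ m → Coprime p m
prime∤⇒coprime pp p∤m (d∣p , d∣m) with prime⇒irreducible pp d∣p
... | inj₁ d≡1  = d≡1
... | inj₂ refl = ⊥-elim (p∤m d∣m)

coprime-^ : ∀ {p m} → Coprime p m → ∀ k → Coprime (p ^ k) m
coprime-^ c zero    (d∣1 , _) = ℕ∣.∣1⇒≡1 d∣1
coprime-^ {p} {m} c (suc k) (d∣ , d∣m) = coprime-^ c k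
  (Coprimality.coprime-divisor (λ (x∣d , x∣p) → c (x∣p , ℕ∣.∣-trans x∣d d∣m)) d∣ , d∣m)

bézout : ∀ {m n} → Coprime m n → ∃ λ u → ∃ λ v → u * + m + v * + n ≡ 1ℤ
bézout {m} {n} c with Coprimality.coprime-Bézout c
... | GCD.Bézout.+- x y eq = + x , - + y , ≡-from-difference (lemma (+ x) (+ m) (+ y) (+ n)) (i-j≡0 (sym eq′))
  where
  lemma : ∀ x m y n → (x * m + (- y) * n) - 1ℤ ≡ x * m - (1ℤ + y * n)
  lemma = solve-∀
  eq′ : 1ℤ + + y * + n ≡ + x * + m
  eq′ = trans (cong (_+_ (1ℤ)) (sym (ℤₚ.pos-* y n))) (trans (cong +_ eq) (ℤₚ.pos-* x m))
... | GCD.Bézout.-+ x y eq = - + x , + y , ≡-from-difference (lemma (+ x) (+ m) (+ y) (+ n)) (i-j≡0 (sym eq′))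
  where
  lemma : ∀ x m y n → ((- x) * m + y * n) - 1ℤ ≡ y * n - (1ℤ + x * m)
  lemma = solve-∀
  eq′ : 1ℤ + + x * + m ≡ + y * + n
  eq′ = trans (cong (_+_ (1ℤ)) (sym (ℤₚ.pos-* x m))) (trans (cong +_ eq) (ℤₚ.pos-* y n))

abstract
  valuation : ∀ {p} → Prime p → ∀ n → n ≢ 0 → ∃ λ k → ∃ λ m → n ≡ p ^ k ℕ.* m × ¬ p ∣ m
  valuation {p} pp n n≢0 = go n n≢0 (<-wellFounded n)
    where
    go : ∀ n → n ≢ 0 → Acc ℕ._<_ n → ∃ λ k → ∃ λ m → n ≡ p ^ k ℕ.* m × ¬ p ∣ m
    go n n≢0 (acc rec) with p ℕ∣.∣? n
    ... | no p∤n = 0 , n , sym (ℕₚ.*-identityˡ n) , p∤n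
    ... | yes (divides q refl) with go q q≢0 (rec q<)
      where
      q≢0 : q ≢ 0
      q≢0 refl = n≢0 refl
      instance
        p-nonTrivial : ℕ.NonTrivial p
        p-nonTrivial = prime⇒nonTrivial pp
        q-nonZero : ℕ.NonZero q
        q-nonZero = ℕ.≢-nonZero q≢0
      q< : q ℕ.< q ℕ.* p
      q< = ℕₚ.m<m*n q p (ℕ.nonTrivial⇒n>1 p)
    ... | k , m , refl , p∤m = suc k , m , trans (ℕₚ.*-comm (p ^ k ℕ.* m) p) (sym (ℕₚ.*-assoc p (p ^ k) m)) , p∤m

p^k≢0 : ∀ {p} → Prime p → ∀ k → p ^ k ≢ 0
p^k≢0 {p} pp k eq = ℕ.≢-nonZero⁻¹ (p ^ k) {{ℕₚ.m^n≢0 p k {{prime⇒nonZero pp}}}} eq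

¬p^[1+k]∣p^k : ∀ {p} → Prime p → ∀ k m → ¬ p ∣ m → ¬ p ^ suc k ∣ p ^ k ℕ.* m
¬p^[1+k]∣p^k {p} pp k m p∤m d = p∤m (ℕ∣.*-cancelˡ-∣ (p ^ k) (subst (_∣ p ^ k ℕ.* m) (ℕₚ.*-comm p (p ^ k)) d))
  where instance _ = ℕ.≢-nonZero (p^k≢0 pp k)

-- Binomial coefficients

binom : ℕ → ℕ → ℕ
binom n       zero    = 1
binom zero    (suc k) = 0
binom (suc n) (suc k) = binom n k ℕ.+ binom n (suc k)

-- Pascal's rule splits the binomial coefficient on the left, both parts are absorbed by induction,
-- and Pascal's rule reassembles them. The calculation is moved to ℤ for the ring solver.
binom-absorb : ∀ n k → suc k ℕ.* binom (suc n) (suc k) ≡ suc n ℕ.* binom n k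
binom-absorb zero    zero    = refl
binom-absorb zero    (suc k) = ℕₚ.*-zeroʳ k
binom-absorb (suc n) zero    = trans (ℕₚ.+-identityʳ _) (trans (cong suc h) (sym (ℕₚ.*-identityʳ (2 ℕ.+ n))))
  where
  h : binom (suc n) 1 ≡ suc n
  h = trans (sym (ℕₚ.+-identityʳ _)) (trans (binom-absorb n zero) (ℕₚ.*-identityʳ (suc n)))
binom-absorb (suc n) (suc k) = ℤₚ.+-injective (begin
  + ((2 ℕ.+ k) ℕ.* (A ℕ.+ B))      ≡⟨ toℤ ⟩
  (1ℤ + (1ℤ + K)) * (+ A + + B)    ≡⟨ lem₁ K (+ A) (+ B) ⟩
  ((1ℤ + K) * + A + + A) + (1ℤ + (1ℤ + K)) * + B ≡⟨ cong₂ (λ x y → (x + + A) + y) ih₁ ih₂ ⟩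
  ((1ℤ + N) * + binom n k + + A) + (1ℤ + N) * + binom n (suc k) ≡⟨ lem₂ N (+ binom n k) (+ binom n (suc k)) (+ A) ⟩
  (1ℤ + N) * (+ binom n k + + binom n (suc k)) + + A ≡⟨ refl ⟩
  (1ℤ + N) * + A + + A             ≡⟨ lem₃ N (+ A) ⟩
  (1ℤ + (1ℤ + N)) * + A            ≡⟨ sym (ℤₚ.pos-* (2 ℕ.+ n) A) ⟩
  + ((2 ℕ.+ n) ℕ.* A)              ∎)
  where
  open ≡-Reasoning
  A B : ℕ
  A = binom (suc n) (suc k)
  B = binom (suc n) (suc (suc k))
  K N : ℤ
  K = + k
  N = + n
  lem₁ : ∀ K A B → (1ℤ + (1ℤ + K)) * (A + B) ≡ ((1ℤ + K) * A + A) + (1ℤ + (1ℤ + K)) * B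
  lem₁ = solve-∀
  lem₂ : ∀ N a b A → ((1ℤ + N) * a + A) + (1ℤ + N) * b ≡ (1ℤ + N) * (a + b) + A
  lem₂ = solve-∀
  lem₃ : ∀ N A → (1ℤ + N) * A + A ≡ (1ℤ + (1ℤ + N)) * A
  lem₃ = solve-∀
  toℤ : + ((2 ℕ.+ k) ℕ.* (A ℕ.+ B)) ≡ (1ℤ + (1ℤ + K)) * (+ A + + B)
  toℤ = ℤₚ.pos-* (2 ℕ.+ k) (A ℕ.+ B)
  ih₁ : (1ℤ + K) * + A ≡ (1ℤ + N) * + binom n k
  ih₁ = trans (sym (ℤₚ.pos-* (suc k) A)) (trans (cong +_ (binom-absorb n k)) (ℤₚ.pos-* (suc n) (binom n k)))
  ih₂ : (1ℤ + (1ℤ + K)) * + B ≡ (1ℤ + N) * + binom n (suc k)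
  ih₂ = trans (sym (ℤₚ.pos-* (2 ℕ.+ k) B)) (trans (cong +_ (binom-absorb n (suc k))) (ℤₚ.pos-* (suc n) (binom n (suc k))))

-- For 0 < j < p^k and p^k ∣ n + 1, absorption gives p ∣ C(n+1,j), so by Pascal's rule
-- p ∤ C(n,j) propagates from j = 0.
p∤binom-pred : ∀ {p} → Prime p → ∀ k n → p ^ k ∣ suc n → ∀ j → j ℕ.< p ^ k → ¬ p ∣ binom n j
p∤binom-pred {p} pp k n q∣ zero j<  p∣1 = ¬prime[1] (subst Prime (ℕ∣.∣1⇒≡1 p∣1) pp)
p∤binom-pred {p} pp k n q∣ (suc j) j< p∣b with p ℕ∣.∣? binom (suc n) (suc j)
... | yes p∣c = p∤binom-pred pp k n q∣ j (ℕₚ.<-trans ℕₚ.≤-refl j<) (ℕ∣.∣m+n∣m⇒∣n (subst (p ∣_) (ℕₚ.+-comm (binom n j) _) p∣c) p∣b)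
... | no p∤c = ℕₚ.<⇒≱ j< (ℕ∣.∣⇒≤ (Coprimality.coprime-divisor (coprime-^ (prime∤⇒coprime pp p∤c) k)
        (subst (p ^ k ∣_) (trans (sym (binom-absorb n j)) (ℕₚ.*-comm (suc j) _)) (ℕ∣.∣m⇒∣m*n (binom n j) q∣))))

-- With q = p^k, absorption gives C(qm, q) = m · C(qm - 1, q - 1), and p divides neither factor.
p∤binom : ∀ {p} → Prime p → ∀ k m → ¬ p ∣ m → ¬ p ∣ binom (p ^ k ℕ.* m) (p ^ k)
p∤binom {p} pp k zero p∤m = ⊥-elim (p∤m (p ℕ∣.∣0))
p∤binom {p} pp k m@(suc _) p∤m p∣b = go (p ^ k) (p ^ k ℕ.* m) refl refl p∣b
  where
  -- p^k and p^k m become variables so that both can be matched as successors.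
  go : ∀ q n → q ≡ p ^ k → n ≡ q ℕ.* m → ¬ p ∣ binom n q
  go zero    n       eq _ _ = p^k≢0 pp k (sym eq)
  go (suc q) zero    eq () _
  go (suc q) (suc n) eq eq′ d = p∤binom-pred pp k n (subst (p ^ k ∣_) (sym (trans eq′ (cong (ℕ._* m) eq))) (ℕ∣.m∣m*n m)) q
      (subst (q ℕ.<_) eq ℕₚ.≤-refl) (Coprimality.coprime-divisor (prime∤⇒coprime pp p∤m) (subst (p ∣_) rearranged d))
    where
    rearranged : binom (suc n) (suc q) ≡ m ℕ.* binom n q
    rearranged = ℕₚ.*-cancelˡ-≡ _ _ (suc q) (trans (binom-absorb n q)
      (trans (cong (ℕ._* binom n q) eq′) (ℕₚ.*-assoc (suc q) m _)))

-- Subsets of Fin n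

module _ {n : ℕ} where

  ⟪_⟫ : ∀ {P : Fin n → Set} → (∀ x → Dec (P x)) → Subset n
  ⟪ P? ⟫ = tabulate (λ x → does (P? x))

  ∈⟪⟫⁺ : ∀ {P : Fin n → Set} (P? : ∀ x → Dec (P x)) {x} → P x → x ∈ ⟪ P? ⟫
  ∈⟪⟫⁺ P? {x} px with P? x in eq
  ... | yes _  = Vecₚ.lookup⇒[]= x _ (trans (Vecₚ.lookup∘tabulate _ x) (cong does eq))
  ... | no ¬px = ⊥-elim (¬px px)

  ∈⟪⟫⁻ : ∀ {P : Fin n → Set} (P? : ∀ x → Dec (P x)) {x} → x ∈ ⟪ P? ⟫ → P x
  ∈⟪⟫⁻ P? {x} x∈ with P? x in eq
  ... | yes px = px
  ... | no ¬px with trans (sym (trans (Vecₚ.lookup∘tabulate _ x) (cong does eq))) (Vecₚ.[]=⇒lookup x∈)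
  ...   | ()

  _≟ₛ_ : DecidableEquality (Subset n)
  _≟ₛ_ = Vecₚ.≡-dec Boolₚ._≟_

  -- For nonempty `S` the choice depends on `S` alone, so equal cosets get equal representatives;
  -- `d` is the value at the empty subset.
  pick : Subset n → Fin n → Fin n
  pick S d with Finₚ.any? (_∈? S)
  ... | yes (x , _) = x
  ... | no _        = d

  pick-∈ : ∀ S d {x} → x ∈ S → pick S d ∈ S
  pick-∈ S d {x} x∈ with Finₚ.any? (_∈? S)
  ... | yes (_ , y∈) = y∈
  ... | no ∉         = ⊥-elim (∉ (x , x∈))

  pick-default : ∀ S d d′ {x} → x ∈ S → pick S d ≡ pick S d′
  pick-default S d d′ {x} x∈ with Finₚ.any? (_∈? S)
  ... | yes _ = refl
  ... | no ∉  = ⊥-elim (∉ (x , x∈))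

∑-allFin-suc : ∀ n (φ : Fin (suc n) → ℤ) → ∑ (allFin (suc n)) φ ≡ φ zero + ∑ (allFin n) (λ x → φ (suc x))
∑-allFin-suc n φ = cong (_+_ (φ zero)) (trans (cong (λ xs → ∑ xs φ) (sym (Listₚ.map-tabulate id suc))) (∑-map (allFin n)))
  where
  ∑-map : ∀ xs → ∑ (map suc xs) φ ≡ ∑ xs (λ x → φ (suc x))
  ∑-map []       = refl
  ∑-map (x ∷ xs) = cong (_+_ (φ (suc x))) (∑-map xs)

∣∣-∑ : ∀ {n} (S : Subset n) → + ∣ S ∣ ≡ ∑ (allFin n) (λ x → ⟦ x ∈? S ⟧)
∣∣-∑ []            = refl
∣∣-∑ {suc n} (s ∷ S) = trans (head s) (sym (∑-allFin-suc n (λ x → ⟦ x ∈? (s ∷ S) ⟧)))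
  where
  tail : ∀ s → ∑ (allFin n) (λ x → ⟦ suc x ∈? (s ∷ S) ⟧) ≡ + ∣ S ∣
  tail s = trans (∑-cong (allFin n) (λ x → ⟦⟧-cong (suc x ∈? (s ∷ S)) (x ∈? S) drop-there there)) (sym (∣∣-∑ S))
  head : ∀ s → + ∣ s ∷ S ∣ ≡ ⟦ zero ∈? (s ∷ S) ⟧ + ∑ (allFin n) (λ x → ⟦ suc x ∈? (s ∷ S) ⟧)
  head inside  = sym (cong (_+_ 1ℤ) (tail inside))
  head outside = sym (trans (ℤₚ.+-identityˡ _) (tail outside))

-- The recursion mirrors Pascal's rule, so that the length is `binom ∣ S ∣ k` by the same case
-- split.
subsetsOf : ∀ {n} → Subset n → ℕ → List (Subset n)
subsetsOf []            zero    = [] ∷ []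
subsetsOf []            (suc k) = []
subsetsOf (outside ∷ S) k       = map (outside ∷_) (subsetsOf S k)
subsetsOf (inside ∷ S)  zero    = map (outside ∷_) (subsetsOf S zero)
subsetsOf (inside ∷ S)  (suc k) = map (inside ∷_) (subsetsOf S k) ++ map (outside ∷_) (subsetsOf S (suc k))

subsetsOf-length : ∀ {n} (S : Subset n) k → length (subsetsOf S k) ≡ binom ∣ S ∣ k
subsetsOf-length []            zero    = refl
subsetsOf-length []            (suc k) = refl
subsetsOf-length (outside ∷ S) k       = trans (Listₚ.length-map _ (subsetsOf S k)) (subsetsOf-length S k)
subsetsOf-length (inside ∷ S)  zero    = trans (Listₚ.length-map _ (subsetsOf S zero)) (subsetsOf-length S zero)
subsetsOf-length (inside ∷ S)  (suc k) = trans (Listₚ.length-++ (map (inside ∷_) (subsetsOf S k)))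
  (cong₂ ℕ._+_ (trans (Listₚ.length-map _ (subsetsOf S k)) (subsetsOf-length S k))
               (trans (Listₚ.length-map _ (subsetsOf S (suc k))) (subsetsOf-length S (suc k))))

subsetsOf-unique : ∀ {n} (S : Subset n) k → Unique (subsetsOf S k)
subsetsOf-unique []            zero    = All.[] ∷ []
subsetsOf-unique []            (suc k) = []
subsetsOf-unique (outside ∷ S) k       = Uniqueₚ.map⁺ Vecₚ.∷-injectiveʳ (subsetsOf-unique S k)
subsetsOf-unique (inside ∷ S)  zero    = Uniqueₚ.map⁺ Vecₚ.∷-injectiveʳ (subsetsOf-unique S zero)
subsetsOf-unique (inside ∷ S)  (suc k) = Uniqueₚ.++⁺
  (Uniqueₚ.map⁺ Vecₚ.∷-injectiveʳ (subsetsOf-unique S k)) (Uniqueₚ.map⁺ Vecₚ.∷-injectiveʳ (subsetsOf-unique S (suc k))) disjoint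
  where
  disjoint : ∀ {v} → ¬ (v ∈ₗ map (inside ∷_) (subsetsOf S k) × v ∈ₗ map (outside ∷_) (subsetsOf S (suc k)))
  disjoint (v∈₁ , v∈₂) with ∈ₗ.∈-map⁻ (inside ∷_) v∈₁ | ∈ₗ.∈-map⁻ (outside ∷_) v∈₂
  ... | _ , _ , refl | _ , _ , ()

∈-subsetsOf⁺ : ∀ {n} (S : Subset n) k {V} → V ⊆ S → ∣ V ∣ ≡ k → V ∈ₗ subsetsOf S k
∈-subsetsOf⁺ []            zero    {[]}          V⊆ c = here refl
∈-subsetsOf⁺ (outside ∷ S) k       {outside ∷ V} V⊆ c = ∈ₗ.∈-map⁺ _ (∈-subsetsOf⁺ S k (drop-∷-⊆ V⊆) c)
∈-subsetsOf⁺ (outside ∷ S) k       {inside ∷ V}  V⊆ c with V⊆ here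
... | ()
∈-subsetsOf⁺ (inside ∷ S)  zero    {outside ∷ V} V⊆ c = ∈ₗ.∈-map⁺ _ (∈-subsetsOf⁺ S zero (drop-∷-⊆ V⊆) c)
∈-subsetsOf⁺ (inside ∷ S)  (suc k) {outside ∷ V} V⊆ c =
  ∈ₗ.∈-++⁺ʳ (map (inside ∷_) (subsetsOf S k)) (∈ₗ.∈-map⁺ _ (∈-subsetsOf⁺ S (suc k) (drop-∷-⊆ V⊆) c))
∈-subsetsOf⁺ (inside ∷ S)  (suc k) {inside ∷ V}  V⊆ c =
  ∈ₗ.∈-++⁺ˡ (∈ₗ.∈-map⁺ _ (∈-subsetsOf⁺ S k (drop-∷-⊆ V⊆) (ℕₚ.suc-injective c)))

∈-subsetsOf⁻ : ∀ {n} (S : Subset n) k {V} → V ∈ₗ subsetsOf S k → V ⊆ S × ∣ V ∣ ≡ k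
∈-subsetsOf⁻ []            zero    (here refl) = id , refl
∈-subsetsOf⁻ (outside ∷ S) k       V∈ with ∈ₗ.∈-map⁻ (outside ∷_) V∈
... | V , V∈′ , refl with ∈-subsetsOf⁻ S k V∈′
... | V⊆ , c = (λ { (there x∈) → there (V⊆ x∈) }) , c
∈-subsetsOf⁻ (inside ∷ S)  zero    V∈ with ∈ₗ.∈-map⁻ (outside ∷_) V∈
... | V , V∈′ , refl with ∈-subsetsOf⁻ S zero V∈′
... | V⊆ , c = (λ { (there x∈) → there (V⊆ x∈) }) , c
∈-subsetsOf⁻ (inside ∷ S)  (suc k) V∈ with ∈ₗ.∈-++⁻ (map (inside ∷_) (subsetsOf S k)) V∈
... | inj₁ V∈₁ with ∈ₗ.∈-map⁻ (inside ∷_) V∈₁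
...   | V , V∈′ , refl with ∈-subsetsOf⁻ S k V∈′
...     | V⊆ , c = (λ { here → here ; (there x∈) → there (V⊆ x∈) }) , cong suc c
∈-subsetsOf⁻ (inside ∷ S)  (suc k) V∈ | inj₂ V∈₂ with ∈ₗ.∈-map⁻ (outside ∷_) V∈₂
...   | V , V∈′ , refl with ∈-subsetsOf⁻ S (suc k) V∈′
...     | V⊆ , c = (λ { (there x∈) → there (V⊆ x∈) }) , c

-- Finite groups

module GroupLemmas (G : FinGroup) where
  open FinGroup G public

  group : Group 0ℓ 0ℓ
  group = record
    { Carrier = El G ; _≈_ = _≡_ ; _∙_ = _·_ ; ε = e ; _⁻¹ = inv
    ; isGroup = record
      { isMonoid = record
        { isSemigroup = record
          { isMagma = record { isEquivalence = isEquivalence ; ∙-cong = cong₂ _·_ }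
          ; assoc = assoc }
        ; identity = idˡ , idʳ }
      ; inverse = invˡ , invʳ
      ; ⁻¹-cong = cong inv } }

  open GroupProperties group public using ()
    renaming (⁻¹-involutive to inv-inv; ⁻¹-anti-homo-∙ to inv-·; ε⁻¹≈ε to inv-e; ∙-cancelˡ to ·-cancelˡ; ∙-cancelʳ to ·-cancelʳ)

  x⁻¹xy : ∀ x y → inv x · (x · y) ≡ y
  x⁻¹xy x y = trans (sym (assoc _ _ _)) (trans (cong (_· y) (invˡ x)) (idˡ y))

  xx⁻¹y : ∀ x y → x · (inv x · y) ≡ y
  xx⁻¹y x y = trans (sym (assoc _ _ _)) (trans (cong (_· y) (invʳ x)) (idˡ y))

  xyy⁻¹ : ∀ x y → (x · y) · inv y ≡ x
  xyy⁻¹ x y = trans (assoc _ _ _) (trans (cong (x ·_) (invʳ y)) (idʳ x))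

  xy⁻¹y : ∀ x y → (x · inv y) · y ≡ x
  xy⁻¹y x y = trans (assoc _ _ _) (trans (cong (x ·_) (invˡ y)) (idʳ x))

  [gx]⁻¹gy : ∀ g x y → inv (g · x) · (g · y) ≡ inv x · y
  [gx]⁻¹gy g x y = trans (cong (_· (g · y)) (inv-· g x)) (trans (assoc _ _ _) (cong (inv x ·_) (x⁻¹xy g y)))

  telescope : ∀ x y z → (inv x · y) · (inv y · z) ≡ inv x · z
  telescope x y z = trans (assoc _ _ _) (cong (inv x ·_) (xx⁻¹y y z))

  ∑G : (El G → ℤ) → ℤ
  ∑G = ∑ (allFin order)

  ∑G-δ : ∀ a (φ : El G → ℤ) → ∑G (λ x → ⟦ a Finₚ.≟ x ⟧ * φ x) ≡ φ a
  ∑G-δ a = ∑-δ Finₚ._≟_ (Uniqueₚ.allFin⁺ order) (∈ₗ.∈-allFin a)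

  -- Both sides are the sum of φ(y) over the pairs with f(x) = y, taken in the two possible orders.
  ∑G-reindex : ∀ (f f⁻¹ : El G → El G) → (∀ x → f⁻¹ (f x) ≡ x) → (∀ y → f (f⁻¹ y) ≡ y) →
               ∀ (φ : El G → ℤ) → ∑G (λ x → φ (f x)) ≡ ∑G φ
  ∑G-reindex f f⁻¹ f⁻¹f ff⁻¹ φ = begin
    ∑G (λ x → φ (f x))                            ≡⟨ ∑-cong (allFin order) (λ x → sym (∑G-δ (f x) φ)) ⟩
    ∑G (λ x → ∑G (λ y → ⟦ f x Finₚ.≟ y ⟧ * φ y))   ≡⟨ ∑-swap (allFin order) (allFin order) _ ⟩
    ∑G (λ y → ∑G (λ x → ⟦ f x Finₚ.≟ y ⟧ * φ y))   ≡⟨ ∑-cong (allFin order) (λ y → ∑-cong (allFin order) (λ x →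
        ⟦⟧*-cong (f x Finₚ.≟ y) (f⁻¹ y Finₚ.≟ x)
          (λ eq → trans (cong f⁻¹ (sym eq)) (f⁻¹f x))
          (λ eq → trans (cong f (sym eq)) (ff⁻¹ y)) {φ y} {φ y} (λ _ → refl))) ⟩
    ∑G (λ y → ∑G (λ x → ⟦ f⁻¹ y Finₚ.≟ x ⟧ * φ y)) ≡⟨ ∑-cong (allFin order) (λ y → ∑G-δ (f⁻¹ y) (λ _ → φ y)) ⟩
    ∑G φ ∎
    where open ≡-Reasoning

  ∑G-translate : ∀ g (φ : El G → ℤ) → ∑G (λ x → φ (g · x)) ≡ ∑G φ
  ∑G-translate g = ∑G-reindex (g ·_) (inv g ·_) (x⁻¹xy g) (xx⁻¹y g)

  module Subgroup {P : Sub G} (P≤ : IsSubgroup G P) where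
    e∈ : e ∈ P
    e∈ = proj₁ P≤
    ·∈ : ∀ {x y} → x ∈ P → y ∈ P → x · y ∈ P
    ·∈ = proj₁ (proj₂ P≤) _ _
    inv∈ : ∀ {x} → x ∈ P → inv x ∈ P
    inv∈ = proj₂ (proj₂ P≤) _

    inv∈⁻ : ∀ {x} → inv x ∈ P → x ∈ P
    inv∈⁻ x∈ = subst (_∈ P) (inv-inv _) (inv∈ x∈)

    ·∈⁻ : ∀ {x y} → x ∈ P → x · y ∈ P → y ∈ P
    ·∈⁻ {x} {y} x∈ xy∈ = subst (_∈ P) (x⁻¹xy x y) (·∈ (inv∈ x∈) xy∈)

    ·∈⁻ʳ : ∀ {x y} → y ∈ P → x · y ∈ P → x ∈ P
    ·∈⁻ʳ {x} {y} y∈ xy∈ = subst (_∈ P) (xyy⁻¹ x y) (·∈ xy∈ (inv∈ y∈))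

    ∣P∣≢0 : ∣ P ∣ ≢ 0
    ∣P∣≢0 eq = nonempty P e∈ eq
      where
      nonempty : ∀ {n x} (S : Subset n) → x ∈ S → ∣ S ∣ ≢ 0
      nonempty (inside ∷ S)  _           ()
      nonempty (outside ∷ S) (there x∈) eq = nonempty S x∈ eq

    coset? : ∀ a x → Dec (x · inv a ∈ P)
    coset? a x = (x · inv a) ∈? P

    rep : El G → El G
    rep a = pick ⟪ coset? a ⟫ a

    a∈coset : ∀ a → a ∈ ⟪ coset? a ⟫
    a∈coset a = ∈⟪⟫⁺ (coset? a) (subst (_∈ P) (sym (invʳ a)) e∈)

    rep-coset : ∀ a → rep a · inv a ∈ P
    rep-coset a = ∈⟪⟫⁻ (coset? a) (pick-∈ _ a (a∈coset a))

    rep-· : ∀ {p} a → p ∈ P → rep (p · a) ≡ rep a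
    rep-· {p} a p∈ = trans (cong (λ S → pick S (p · a)) (⊆-antisym forth back)) (pick-default _ _ a (a∈coset a))
      where
      shift : ∀ x → x · inv (p · a) ≡ (x · inv a) · inv p
      shift x = trans (cong (x ·_) (inv-· p a)) (sym (assoc _ _ _))
      forth : ⟪ coset? (p · a) ⟫ ⊆ ⟪ coset? a ⟫
      forth {x} x∈ = ∈⟪⟫⁺ (coset? a) (·∈⁻ʳ (inv∈ p∈) (subst (_∈ P) (shift x) (∈⟪⟫⁻ (coset? (p · a)) x∈)))
      back : ⟪ coset? a ⟫ ⊆ ⟪ coset? (p · a) ⟫
      back {x} x∈ = ∈⟪⟫⁺ (coset? (p · a)) (subst (_∈ P) (sym (shift x)) (·∈ (∈⟪⟫⁻ (coset? a) x∈) (inv∈ p∈)))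

    -- The P-equivariant projection G → P belonging to the chosen right coset representatives: a =
    -- `retract a` · `rep a`.
    retract : El G → El G
    retract a = a · inv (rep a)

    retract-∈ : ∀ a → retract a ∈ P
    retract-∈ a = inv∈⁻ (subst (_∈ P) (sym (trans (inv-· a (inv (rep a))) (cong (_· inv a) (inv-inv (rep a))))) (rep-coset a))

    retract-· : ∀ {p} a → p ∈ P → retract (p · a) ≡ p · retract a
    retract-· {p} a p∈ = trans (cong (λ t → (p · a) · inv t) (rep-· a p∈)) (assoc _ _ _)

    -- Inversion exchanges left and right cosets.
    repˡ : El G → El G
    repˡ s = inv (rep (inv s))

    repˡ-coset : ∀ s → inv s · repˡ s ∈ P
    repˡ-coset s = subst (_∈ P) (trans (inv-· _ _) (cong₂ _·_ (cong inv (inv-inv s)) refl)) (inv∈ (rep-coset (inv s)))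

    repˡ-· : ∀ {p} s → p ∈ P → repˡ (s · p) ≡ repˡ s
    repˡ-· {p} s p∈ = cong inv (trans (cong rep (inv-· s p)) (rep-· (inv s) (inv∈ p∈)))

  module Coset {P S : Sub G} (P≤ : IsSubgroup G P) (S≤ : IsSubgroup G S) (P⊆S : P ⊆ S) where
    open Subgroup P≤
    private module S = Subgroup S≤

    -- These t form the transversal of S/P over which the transfer sums.
    repIn? : ∀ t → Dec (t ∈ S × repˡ t ≡ t)
    repIn? t = (t ∈? S) ×-dec (repˡ t Finₚ.≟ t)

    -- Summing over S fibre by fibre along repˡ.
    ∑-cosets : ∀ (φ : El G → ℤ) → (∀ s p → p ∈ P → φ (s · p) ≡ φ s) →
               ∑G (λ s → ⟦ s ∈? S ⟧ * φ s) ≡ + ∣ P ∣ * ∑G (λ t → ⟦ repIn? t ⟧ * φ t)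
    ∑-cosets φ φ-inv = begin
      ∑G (λ s → ⟦ s ∈? S ⟧ * φ s)
        ≡⟨ ∑-cong (allFin order) (λ s → sym (∑G-δ (repˡ s) (λ _ → ⟦ s ∈? S ⟧ * φ s))) ⟩
      ∑G (λ s → ∑G (λ t → ⟦ repˡ s Finₚ.≟ t ⟧ * (⟦ s ∈? S ⟧ * φ s)))
        ≡⟨ ∑-swap (allFin order) (allFin order) _ ⟩
      ∑G (λ t → ∑G (λ s → ⟦ repˡ s Finₚ.≟ t ⟧ * (⟦ s ∈? S ⟧ * φ s)))
        ≡⟨ ∑-cong (allFin order) (λ t → ∑-cong (allFin order) (λ s → fibre s t)) ⟩
      ∑G (λ t → ∑G (λ s → ⟦ (inv t · s) ∈? P ⟧ * (⟦ repIn? t ⟧ * φ t)))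
        ≡⟨ ∑-cong (allFin order) (λ t → ∑-*ʳ (allFin order) (⟦ repIn? t ⟧ * φ t) (λ s → ⟦ (inv t · s) ∈? P ⟧)) ⟩
      ∑G (λ t → ∑G (λ s → ⟦ (inv t · s) ∈? P ⟧) * (⟦ repIn? t ⟧ * φ t))
        ≡⟨ ∑-cong (allFin order) (λ t → cong (_* (⟦ repIn? t ⟧ * φ t)) (trans (∑G-translate (inv t) (λ x → ⟦ x ∈? P ⟧)) (sym (∣∣-∑ P)))) ⟩
      ∑G (λ t → + ∣ P ∣ * (⟦ repIn? t ⟧ * φ t))
        ≡⟨ ∑-*ˡ (allFin order) (+ ∣ P ∣) (λ t → ⟦ repIn? t ⟧ * φ t) ⟩
      + ∣ P ∣ * ∑G (λ t → ⟦ repIn? t ⟧ * φ t) ∎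
      where
      open ≡-Reasoning
      merge : ∀ {A B : Set} (a : Dec A) (b : Dec B) i → ⟦ a ⟧ * (⟦ b ⟧ * i) ≡ ⟦ a ×-dec b ⟧ * i
      merge (yes _) (yes _) i = ℤₚ.*-identityˡ (1ℤ * i)
      merge (yes _) (no _)  i = refl
      merge (no _)  (yes _) i = refl
      merge (no _)  (no _)  i = refl
      fibre : ∀ s t → ⟦ repˡ s Finₚ.≟ t ⟧ * (⟦ s ∈? S ⟧ * φ s) ≡ ⟦ (inv t · s) ∈? P ⟧ * (⟦ repIn? t ⟧ * φ t)
      fibre s t = trans (merge (repˡ s Finₚ.≟ t) (s ∈? S) (φ s)) (trans
        (⟦⟧*-cong ((repˡ s Finₚ.≟ t) ×-dec (s ∈? S)) (((inv t · s) ∈? P) ×-dec repIn? t) forth back values)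
        (sym (merge ((inv t · s) ∈? P) (repIn? t) (φ t))))
        where
        s⁻¹t : repˡ s ≡ t → inv s · t ∈ P
        s⁻¹t eq = subst (λ t → inv s · t ∈ P) eq (repˡ-coset s)
        t⁻¹s : repˡ s ≡ t → inv t · s ∈ P
        t⁻¹s eq = subst (_∈ P) (trans (inv-· _ _) (cong (inv t ·_) (inv-inv s))) (inv∈ (s⁻¹t eq))
        forth : repˡ s ≡ t × s ∈ S → inv t · s ∈ P × (t ∈ S × repˡ t ≡ t)
        forth (eq , s∈) = t⁻¹s eq , subst (_∈ S) (xx⁻¹y s t) (S.·∈ s∈ (P⊆S (s⁻¹t eq)))
          , trans (trans (cong repˡ (sym (xx⁻¹y s t))) (repˡ-· s (s⁻¹t eq))) eq
        back : inv t · s ∈ P × (t ∈ S × repˡ t ≡ t) → repˡ s ≡ t × s ∈ S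
        back (p∈ , t∈ , eq) = trans (cong repˡ (sym (xx⁻¹y t s))) (trans (repˡ-· t p∈) eq)
          , subst (_∈ S) (xx⁻¹y t s) (S.·∈ t∈ (P⊆S p∈))
        values : repˡ s ≡ t × s ∈ S → φ s ≡ φ t
        values (eq , _) = trans (cong φ (sym (xx⁻¹y t s))) (φ-inv t _ (t⁻¹s eq))

    index : ℕ
    index = ∣ ⟪ repIn? ⟫ ∣

    ∑-repIn : ∑G (λ t → ⟦ repIn? t ⟧) ≡ + index
    ∑-repIn = sym (trans (∣∣-∑ ⟪ repIn? ⟫) (∑-cong (allFin order) (λ t → ⟦⟧-cong (t ∈? ⟪ repIn? ⟫) (repIn? t) (∈⟪⟫⁻ repIn?) (∈⟪⟫⁺ repIn?))))

    lagrange : ∣ S ∣ ≡ ∣ P ∣ ℕ.* index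
    lagrange = ℤₚ.+-injective (trans (∣∣-∑ S) (trans (∑-cong (allFin order) (λ s → sym (ℤₚ.*-identityʳ ⟦ s ∈? S ⟧)))
      (trans (∑-cosets (λ _ → 1ℤ) (λ _ _ _ → refl))
      (trans (cong (_*_ (+ ∣ P ∣)) (trans (∑-cong (allFin order) (λ t → ℤₚ.*-identityʳ ⟦ repIn? t ⟧)) ∑-repIn)) (sym (ℤₚ.pos-* ∣ P ∣ index))))))

    -- After multiplication by `∣ P ∣` both sides are sums over all of S, which g permutes.
    -- Cancelling `∣ P ∣` in ℤ spares the description of how g permutes the representatives.
    ∑-reps-translate : ∀ (φ : El G → ℤ) → (∀ s p → p ∈ P → φ (s · p) ≡ φ s) → ∀ {g} → g ∈ S →
                       ∑G (λ t → ⟦ repIn? t ⟧ * φ (g · t)) ≡ ∑G (λ t → ⟦ repIn? t ⟧ * φ t)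
    ∑-reps-translate φ φ-inv {g} g∈ = ℤₚ.*-cancelˡ-≡ (+ ∣ P ∣) _ _ {{nz}} (begin
      + ∣ P ∣ * ∑G (λ t → ⟦ repIn? t ⟧ * φ (g · t))
        ≡⟨ sym (∑-cosets (λ t → φ (g · t)) (λ s p p∈ → trans (cong φ (sym (assoc g s p))) (φ-inv (g · s) p p∈))) ⟩
      ∑G (λ s → ⟦ s ∈? S ⟧ * φ (g · s))
        ≡⟨ ∑-cong (allFin order) (λ s → ⟦⟧*-cong (s ∈? S) ((g · s) ∈? S) (S.·∈ g∈) (S.·∈⁻ g∈) {φ (g · s)} {φ (g · s)} (λ _ → refl)) ⟩
      ∑G (λ s → ⟦ (g · s) ∈? S ⟧ * φ (g · s))
        ≡⟨ ∑G-translate g (λ s → ⟦ s ∈? S ⟧ * φ s) ⟩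
      ∑G (λ s → ⟦ s ∈? S ⟧ * φ s)
        ≡⟨ ∑-cosets φ φ-inv ⟩
      + ∣ P ∣ * ∑G (λ t → ⟦ repIn? t ⟧ * φ t) ∎)
      where
      open ≡-Reasoning
      nz : ℤ.NonZero (+ ∣ P ∣)
      nz = ℤ.≢-nonZero (λ eq → ∣P∣≢0 (ℤₚ.+-injective eq))

-- Sylow subgroups

module SylowExistence (G : FinGroup) where
  open GroupLemmas G

  translate : El G → Sub G → Sub G
  translate s U = ⟪ (λ x → (inv s · x) ∈? U) ⟫

  ∈-translate⁺ : ∀ s U {x} → inv s · x ∈ U → x ∈ translate s U
  ∈-translate⁺ s U = ∈⟪⟫⁺ (λ x → (inv s · x) ∈? U)

  ∈-translate⁻ : ∀ s U {x} → x ∈ translate s U → inv s · x ∈ U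
  ∈-translate⁻ s U = ∈⟪⟫⁻ (λ x → (inv s · x) ∈? U)

  translate-e : ∀ U → translate e U ≡ U
  translate-e U = ⊆-antisym (λ {x} x∈ → subst (_∈ U) (e⁻¹x x) (∈-translate⁻ e U x∈))
                            (λ {x} x∈ → ∈-translate⁺ e U (subst (_∈ U) (sym (e⁻¹x x)) x∈))
    where
    e⁻¹x : ∀ x → inv e · x ≡ x
    e⁻¹x x = trans (cong (_· x) inv-e) (idˡ x)

  translate-· : ∀ s t U → translate s (translate t U) ≡ translate (s · t) U
  translate-· s t U = ⊆-antisym
    (λ {x} x∈ → ∈-translate⁺ (s · t) U (subst (_∈ U) (sym (eq x)) (∈-translate⁻ t U (∈-translate⁻ s (translate t U) x∈))))
    (λ {x} x∈ → ∈-translate⁺ s _ (∈-translate⁺ t U (subst (_∈ U) (eq x) (∈-translate⁻ (s · t) U x∈))))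
    where
    eq : ∀ x → inv (s · t) · x ≡ inv t · (inv s · x)
    eq x = trans (cong (_· x) (inv-· s t)) (assoc _ _ _)

  translate-cancel : ∀ {s U V} → translate s U ≡ V → translate (inv s) V ≡ U
  translate-cancel {s} {U} refl = trans (translate-· (inv s) s U) (trans (cong (λ t → translate t U) (invˡ s)) (translate-e U))

  ∣translate∣ : ∀ s U → ∣ translate s U ∣ ≡ ∣ U ∣
  ∣translate∣ s U = ℤₚ.+-injective (begin
    + ∣ translate s U ∣               ≡⟨ ∣∣-∑ (translate s U) ⟩
    ∑G (λ x → ⟦ x ∈? translate s U ⟧) ≡⟨ ∑-cong (allFin order) (λ x →
       ⟦⟧-cong (x ∈? translate s U) ((inv s · x) ∈? U) (∈-translate⁻ s U) (∈-translate⁺ s U)) ⟩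
    ∑G (λ x → ⟦ (inv s · x) ∈? U ⟧)   ≡⟨ ∑G-translate (inv s) (λ x → ⟦ x ∈? U ⟧) ⟩
    ∑G (λ x → ⟦ x ∈? U ⟧)             ≡⟨ sym (∣∣-∑ U) ⟩
    + ∣ U ∣                           ∎)
    where open ≡-Reasoning

  module _ {S : Sub G} (S≤ : IsSubgroup G S) where
    open Subgroup S≤

    stab? : ∀ U s → Dec (s ∈ S × translate s U ≡ U)
    stab? U s = (s ∈? S) ×-dec (translate s U ≟ₛ U)

    stab : Sub G → Sub G
    stab U = ⟪ stab? U ⟫

    stab-subgroup : ∀ U → IsSubgroup G (stab U)
    stab-subgroup U = ∈⟪⟫⁺ (stab? U) (e∈ , translate-e U)
      , (λ x y x∈ y∈ → let (xS , xU) = ∈⟪⟫⁻ (stab? U) x∈ ; (yS , yU) = ∈⟪⟫⁻ (stab? U) y∈ in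
           ∈⟪⟫⁺ (stab? U) (·∈ xS yS , trans (sym (translate-· x y U)) (trans (cong (translate x) yU) xU)))
      , (λ x x∈ → let (xS , xU) = ∈⟪⟫⁻ (stab? U) x∈ in ∈⟪⟫⁺ (stab? U) (inv∈ xS , translate-cancel xU))

    orbit? : ∀ U V → Dec (∃ λ s → s ∈ S × translate s U ≡ V)
    orbit? U V = Finₚ.any? (λ s → (s ∈? S) ×-dec (translate s U ≟ₛ V))

    -- If V = tU with t ∈ S, the elements of S carrying U to V form the coset t · `stab U`.
    ∑-orbit : ∀ U V → ∑G (λ s → ⟦ (s ∈? S) ×-dec (translate s U ≟ₛ V) ⟧) ≡ ⟦ orbit? U V ⟧ * + ∣ stab U ∣
    ∑-orbit U V with orbit? U V
    ... | no ∄ = trans (∑-cong (allFin order) (λ s → ⟦⟧-false ((s ∈? S) ×-dec (translate s U ≟ₛ V)) (λ p → ∄ (s , p)))) (∑-zero (allFin order))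
    ... | yes (t , t∈ , refl) = begin
      ∑G (λ s → ⟦ (s ∈? S) ×-dec (translate s U ≟ₛ translate t U) ⟧)
        ≡⟨ sym (∑G-translate t (λ s → ⟦ (s ∈? S) ×-dec (translate s U ≟ₛ translate t U) ⟧)) ⟩
      ∑G (λ s → ⟦ ((t · s) ∈? S) ×-dec (translate (t · s) U ≟ₛ translate t U) ⟧)
        ≡⟨ ∑-cong (allFin order) (λ s → ⟦⟧-cong (((t · s) ∈? S) ×-dec (translate (t · s) U ≟ₛ translate t U)) (s ∈? stab U)
             (λ (ts∈ , eq) → ∈⟪⟫⁺ (stab? U) (·∈⁻ t∈ ts∈ ,
                trans (sym (translate-cancel (translate-· t s U))) (translate-cancel (sym eq))))
             (λ s∈ → let (sS , sU) = ∈⟪⟫⁻ (stab? U) s∈ in ·∈ t∈ sS , trans (sym (translate-· t s U)) (cong (translate t) sU))) ⟩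
      ∑G (λ s → ⟦ s ∈? stab U ⟧)
        ≡⟨ sym (∣∣-∑ (stab U)) ⟩
      + ∣ stab U ∣
        ≡⟨ sym (ℤₚ.*-identityˡ (+ ∣ stab U ∣)) ⟩
      1ℤ * + ∣ stab U ∣ ∎
      where open ≡-Reasoning

    module _ (q : ℕ) where
      Ω : List (Sub G)
      Ω = subsetsOf S q

      translate-∈Ω : ∀ {s U} → s ∈ S → U ∈ₗ Ω → translate s U ∈ₗ Ω
      translate-∈Ω {s} {U} s∈ U∈ = let (U⊆ , c) = ∈-subsetsOf⁻ S q U∈ in
        ∈-subsetsOf⁺ S q (λ {x} x∈ → ·∈⁻ (inv∈ s∈) (U⊆ (∈-translate⁻ s U x∈))) (trans (∣translate∣ s U) c)

      -- Count the pairs (s, V) with sU = V: each s ∈ S has exactly one V in `Ω`, and each V in the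
      -- orbit is reached by `∣ stab U ∣` elements.
      orbit-stabilizer : ∀ {U} → U ∈ₗ Ω → + ∣ S ∣ ≡ ∑ Ω (λ V → ⟦ orbit? U V ⟧) * + ∣ stab U ∣
      orbit-stabilizer {U} U∈ = begin
        + ∣ S ∣
          ≡⟨ ∣∣-∑ S ⟩
        ∑G (λ s → ⟦ s ∈? S ⟧)
          ≡⟨ ∑-cong (allFin order) expand ⟩
        ∑G (λ s → ∑ Ω (λ V → ⟦ (s ∈? S) ×-dec (translate s U ≟ₛ V) ⟧))
          ≡⟨ ∑-swap (allFin order) Ω _ ⟩
        ∑ Ω (λ V → ∑G (λ s → ⟦ (s ∈? S) ×-dec (translate s U ≟ₛ V) ⟧))
          ≡⟨ ∑-cong Ω (∑-orbit U) ⟩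
        ∑ Ω (λ V → ⟦ orbit? U V ⟧ * + ∣ stab U ∣)
          ≡⟨ ∑-*ʳ Ω (+ ∣ stab U ∣) (λ V → ⟦ orbit? U V ⟧) ⟩
        ∑ Ω (λ V → ⟦ orbit? U V ⟧) * + ∣ stab U ∣ ∎
        where
        open ≡-Reasoning
        expand : ∀ s → ⟦ s ∈? S ⟧ ≡ ∑ Ω (λ V → ⟦ (s ∈? S) ×-dec (translate s U ≟ₛ V) ⟧)
        expand s with s ∈? S
        ... | no s∉ = sym (trans (∑-cong Ω (λ V → ⟦⟧-false (no s∉ ×-dec (translate s U ≟ₛ V)) (λ p → s∉ (proj₁ p)))) (∑-zero Ω))
        ... | yes s∈ = sym (trans (∑-cong Ω (λ V → trans
                (⟦⟧-cong (yes s∈ ×-dec (translate s U ≟ₛ V)) (translate s U ≟ₛ V) proj₂ (s∈ ,_)) (sym (ℤₚ.*-identityʳ ⟦ translate s U ≟ₛ V ⟧))))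
              (∑-δ _≟ₛ_ (subsetsOf-unique S q) (translate-∈Ω s∈ U∈) (λ _ → 1ℤ)))

    -- s ↦ s·u embeds the stabilizer of U into U.
    ∣stab∣≤ : ∀ U {u} → u ∈ U → ∣ stab U ∣ ℕ.≤ ∣ U ∣
    ∣stab∣≤ U {u} u∈ = subst (ℕ._≤ ∣ U ∣) (ℤₚ.+-injective same) (p⊆q⇒∣p∣≤∣q∣ stabu⊆U)
      where
      su? : ∀ x → Dec (x · inv u ∈ stab U)
      su? x = (x · inv u) ∈? stab U
      stabu : Sub G
      stabu = ⟪ su? ⟫
      stabu⊆U : stabu ⊆ U
      stabu⊆U {x} x∈ = let (_ , fix) = ∈⟪⟫⁻ (stab? U) (∈⟪⟫⁻ su? x∈) in
        subst (x ∈_) fix (∈-translate⁺ (x · inv u) U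
          (subst (_∈ U) (sym (trans (cong (inv (x · inv u) ·_) (sym (xy⁻¹y x u))) (x⁻¹xy (x · inv u) u))) u∈))
      same : + ∣ stabu ∣ ≡ + ∣ stab U ∣
      same = begin
        + ∣ stabu ∣                          ≡⟨ ∣∣-∑ stabu ⟩
        ∑G (λ x → ⟦ x ∈? stabu ⟧)            ≡⟨ ∑-cong (allFin order) (λ x →
            ⟦⟧-cong (x ∈? stabu) ((x · inv u) ∈? stab U) (∈⟪⟫⁻ su?) (∈⟪⟫⁺ su?)) ⟩
        ∑G (λ x → ⟦ (x · inv u) ∈? stab U ⟧) ≡⟨ ∑G-reindex (_· inv u) (_· u) (λ x → xy⁻¹y x u) (λ x → xyy⁻¹ x u) (λ x → ⟦ x ∈? stab U ⟧) ⟩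
        ∑G (λ x → ⟦ x ∈? stab U ⟧)           ≡⟨ sym (∣∣-∑ (stab U)) ⟩
        + ∣ stab U ∣                         ∎
        where open ≡-Reasoning

    nonempty : ∀ {n} (U : Subset n) → ∣ U ∣ ≢ 0 → ∃ λ u → u ∈ U
    nonempty []            c = ⊥-elim (c refl)
    nonempty (inside ∷ U)  c = zero , here
    nonempty (outside ∷ U) c = let (u , u∈) = nonempty U c in suc u , there u∈

    -- Wielandt: p ∤ C(p^k m, p^k), so some p^k-subset of S has an orbit of size prime to p;
    -- its stabilizer has order exactly p^k.
    sylow : ∀ {p} → Prime p → ∃ λ P → IsSylow G p S P
    sylow {p} pp with valuation pp ∣ S ∣ ∣P∣≢0
    ... | k , m , ∣S∣≡ , p∤m with Any.any? (λ U → (p ^ k) ℕ∣.∣? ∣ stab U ∣) (Ω (p ^ k))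
    ... | yes found = P , stab-subgroup U , (λ x∈ → proj₁ (∈⟪⟫⁻ (stab? U) x∈))
                      , k , ∣P∣≡ , subst (p ^ k ∣_) (sym ∣S∣≡) (ℕ∣.m∣m*n m)
                      , (λ d → ¬p^[1+k]∣p^k pp k m p∤m (subst (p ^ suc k ∣_) ∣S∣≡ d))
      where
      q = p ^ k
      U = proj₁ (find found)
      U∈ : U ∈ₗ Ω q
      U∈ = proj₁ (proj₂ (find found))
      P = stab U
      ∣U∣≡ : ∣ U ∣ ≡ q
      ∣U∣≡ = proj₂ (∈-subsetsOf⁻ S q U∈)
      u = nonempty U (λ eq → p^k≢0 pp k (trans (sym ∣U∣≡) eq))
      ∣P∣≡ : ∣ P ∣ ≡ q
      ∣P∣≡ = ℕₚ.≤-antisym (subst (∣ P ∣ ℕ.≤_) ∣U∣≡ (∣stab∣≤ U (proj₂ u)))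
        (ℕ∣.∣⇒≤ {{ℕ.≢-nonZero (Subgroup.∣P∣≢0 (stab-subgroup U))}} (proj₂ (proj₂ (find found))))
    ... | no none = ⊥-elim (p∤binom pp k m p∤m (subst (λ s → p ∣ binom s (p ^ k)) ∣S∣≡ (subst (p ∣_) (subsetsOf-length S (p ^ k))
            (ℤ∣.∣⇒∣ᵤ (subst (+ p ℤ∣.∣_) (∑-length (Ω (p ^ k)))
              (∣-classes orbit? (λ {U} → e , e∈ , translate-e U)
                 (λ (s , s∈ , eq) → inv s , inv∈ s∈ , translate-cancel eq)
                 (λ {U} (s , s∈ , eq) (t , t∈ , eq′) → t · s , ·∈ t∈ s∈ , trans (sym (translate-· t s U)) (trans (cong (translate t) eq) eq′))
                 (+ p) (Ω (p ^ k)) orbits))))))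
      where
      -- If p did not divide the size of the orbit, p^k would divide `∣ stab U ∣`, because the
      -- product of the two is p^k m; `none` excludes this.
      orbits : ∀ U → U ∈ₗ Ω (p ^ k) → + p ℤ∣.∣ ∑ (Ω (p ^ k)) (λ V → ⟦ orbit? U V ⟧)
      orbits U U∈ = ℤ∣.∣ᵤ⇒∣ (decidable-stable (p ℕ∣.∣? _) λ p∤orb →
        none (lose U∈ (Coprimality.coprime-divisor (coprime-^ (prime∤⇒coprime pp p∤orb) k) (divides m (begin
          ℤ.∣ orb ∣ ℕ.* ∣ stab U ∣    ≡⟨ sym (ℤₚ.abs-* orb (+ ∣ stab U ∣)) ⟩
          ℤ.∣ orb * + ∣ stab U ∣ ∣    ≡⟨ cong ℤ.∣_∣ (sym (orbit-stabilizer (p ^ k) U∈)) ⟩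
          ∣ S ∣                       ≡⟨ ∣S∣≡ ⟩
          p ^ k ℕ.* m                 ≡⟨ ℕₚ.*-comm (p ^ k) m ⟩
          m ℕ.* p ^ k                 ∎)))))
        where
        open ≡-Reasoning
        orb = ∑ (Ω (p ^ k)) (λ V → ⟦ orbit? U V ⟧)

-- Cochains with values in J_{G/H}

module Cochains (G : FinGroup) (H : Sub G) where
  open GroupLemmas G

  infix 4 _≈_
  _≈_ : IndFun G → IndFun G → Set
  _≈_ = _≈J_ G

  HInv : IndFun G → Set
  HInv = IsHInv G H

  act-HInv : ∀ {φ} g → HInv φ → HInv (act G g φ)
  act-HInv {φ} g inv-φ h x h∈ = trans (cong φ (assoc h x g)) (inv-φ h (x · g) h∈)

  -- `IsCoboundaryOn` with a predicate in place of a subset; for `_∈ S` the two agree by definition.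
  -- Cyclic groups and conjugates can then be given by their defining property.
  CoboundaryOn : (El G → Set) → Cochain2 G → Set
  CoboundaryOn P f = Σ (Cochain1 G) λ c → IsHInv1 G H c ×
    (∀ g h → P g → P h → f g h ≈ (λ x → (act G g (c h) x - c (g · h) x) + c g x))

  coboundary-⊆ : ∀ {P Q f} → (∀ g → Q g → P g) → CoboundaryOn P f → CoboundaryOn Q f
  coboundary-⊆ Q⊆P (c , inv-c , eq) = c , inv-c , λ g h g∈ h∈ → eq g h (Q⊆P g g∈) (Q⊆P h h∈)

  scale-HInv : ∀ {f} m → IsHInv2 G H f → IsHInv2 G H (scale G m f)
  scale-HInv m inv-f g k h x h∈ = cong (+ m *_) (inv-f g k h x h∈)

  scale-cocycle : ∀ {f} m → IsCocycle2 G f → IsCocycle2 G (scale G m f)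
  scale-cocycle {f} m coc g h k = let (κ , eq) = coc g h k in + m * κ , λ x →
    trans (lemma (+ m) _ _ _ _) (trans (cong (+ m *_) (eq x)) (lemma′ (+ m) κ))
    where
    lemma : ∀ m a b c d → ((m * a - m * b) + m * c) - m * d ≡ m * (((a - b) + c) - d)
    lemma = solve-∀
    lemma′ : ∀ m κ → m * (0ℤ + κ) ≡ 0ℤ + m * κ
    lemma′ = solve-∀

  -- By Bézout, f = u (m f) + v (n f), so the same combination of the two 1-cochains splits f.
  coboundary-coprime : ∀ {P f m n} → Coprime m n → CoboundaryOn P (scale G m f) → CoboundaryOn P (scale G n f) →
                       CoboundaryOn P f
  coboundary-coprime {P} {f} {m} {n} coprime (c , inv-c , eq) (c′ , inv-c′ , eq′) with bézout coprime
  ... | u , v , um+vn = (λ g x → u * c g x + v * c′ g x)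
    , (λ g h x h∈ → cong₂ (λ i j → u * i + v * j) (inv-c g h x h∈) (inv-c′ g h x h∈))
    , λ g h g∈ h∈ → let (κ , E) = eq g h g∈ h∈ ; (κ′ , E′) = eq′ g h g∈ h∈ in
      u * κ + v * κ′ , λ x → trans (unit (f g h x)) (trans (cong₂ (λ i j → u * i + v * j) (E x) (E′ x)) (lemma u v _ _ _ _ _ _ κ κ′))
    where
    unit : ∀ i → i ≡ u * (+ m * i) + v * (+ n * i)
    unit i = trans (sym (ℤₚ.*-identityˡ i)) (trans (cong (_* i) (sym um+vn)) (distrib u (+ m) v (+ n) i))
      where
      distrib : ∀ u m v n i → (u * m + v * n) * i ≡ u * (m * i) + v * (n * i)
      distrib = solve-∀
    lemma : ∀ u v a b c a′ b′ c′ κ κ′ → u * (((a - b) + c) + κ) + v * (((a′ - b′) + c′) + κ′)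
              ≡ (((u * a + v * a′) - (u * b + v * b′)) + (u * c + v * c′)) + (u * κ + v * κ′)
    lemma = solve-∀

  homogeneous : Cochain2 G → El G → El G → El G → IndFun G
  homogeneous f a b c x = f (inv a · b) (inv b · c) (x · a)

  homogeneous-equivariant : ∀ f g a b c x → homogeneous f (g · a) (g · b) (g · c) x ≡ homogeneous f a b c (x · g)
  homogeneous-equivariant f g a b c x =
    trans (cong₂ (λ u v → f u v (x · (g · a))) ([gx]⁻¹gy g a b) ([gx]⁻¹gy g b c))
          (cong (f (inv a · b) (inv b · c)) (sym (assoc x g a)))

  homogeneous-cocycle : ∀ {f} → IsCocycle2 G f → let F = homogeneous f in ∀ a b c d →
    ∃ λ κ → ∀ x → ((F b c d x - F a c d x) + F a b d x) - F a b c x ≡ κ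
  homogeneous-cocycle {f} coc a b c d = let (κ , eq) = coc (inv a · b) (inv b · c) (inv c · d) in κ , λ x →
    trans (cong (λ i → i - homogeneous f a b c x)
        (cong₂ _+_ (cong₂ _-_ (cong (f (inv b · c) (inv c · d)) (sym (trans (assoc x a _) (cong (x ·_) (xx⁻¹y a b)))))
                              (cong (λ u → f u (inv c · d) (x · a)) (sym (telescope a b c))))
                   (cong (λ v → f (inv a · b) v (x · a)) (sym (telescope b c d)))))
      (trans (eq (x · a)) (ℤₚ.+-identityˡ κ))

  -- A P-equivariant homogeneous 1-cochain on all of G with coboundary f.  Having it defined on G
  -- rather than on P makes conjugation and transfer plain substitutions.
  record Primitive (P : El G → Set) (f : Cochain2 G) : Set where
    field
      B           : El G → El G → IndFun G
      B-HInv      : ∀ a b → HInv (B a b)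
      equivariant : ∀ p a b → P p → B (p · a) (p · b) ≈ act G p (B a b)
      coboundary  : ∀ a b c → homogeneous f a b c ≈ (λ x → (B b c x - B a c x) + B a b x)

  -- Dehomogenise by c(g) = B(e, g): equivariance turns the term B(g, gh) of the coboundary at (e,
  -- g, gh) into g·B(e, h).
  fromPrimitive : ∀ {P f} → Primitive P f → CoboundaryOn P f
  fromPrimitive {P} {f} prim = (λ g → B e g) , (λ g → B-HInv e g) , λ g h g∈ h∈ →
    let (κ , eq) = coboundary e g (g · h) ; (κ′ , eq′) = equivariant g e h g∈ in
    κ + κ′ , λ x → trans (start g h x) (trans (eq x) (trans
      (cong (λ i → ((i - B e (g · h) x) + B e g x) + κ) (trans (cong (λ u → B u (g · h) x) (sym (idʳ g))) (eq′ x)))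
      (lemma (B e h (x · g)) κ′ (B e (g · h) x) (B e g x) κ)))
    where
    open Primitive prim
    start : ∀ g h x → f g h x ≡ homogeneous f e g (g · h) x
    start g h x = trans (cong₂ (λ u v → f u v x) (sym (trans (cong (_· g) inv-e) (idˡ g))) (sym (x⁻¹xy g h)))
                        (cong (f (inv e · g) (inv g · (g · h))) (sym (idʳ x)))
    lemma : ∀ a k b c l → (((a + k) - b) + c) + l ≡ ((a - b) + c) + (l + k)
    lemma = solve-∀

  -- The homogeneous form of f is equivariant under all of G, so y⁻¹·B(ya, yb) has the same
  -- coboundary as B, while its equivariance group is y⁻¹Py. The cocycle f itself stays unchanged.
  conjPrimitive : ∀ {P f} y → Primitive P f → Primitive (λ g → P ((y · g) · inv y)) f
  conjPrimitive {P} {f} y prim = record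
    { B           = B′
    ; B-HInv      = λ a b → act-HInv (inv y) (B-HInv (y · a) (y · b))
    ; equivariant = λ g a b g∈ → let (κ , eq) = equivariant ((y · g) · inv y) (y · a) (y · b) g∈ in κ , λ x →
        trans (cong₂ (λ u v → B u v (x · inv y)) (move g a) (move g b))
        (trans (eq (x · inv y)) (cong (λ z → B (y · a) (y · b) z + κ) (point g x)))
    ; coboundary  = λ a b c → let (κ , eq) = coboundary (y · a) (y · b) (y · c) in κ , λ x →
        trans (trans (cong (homogeneous f a b c) (sym (xy⁻¹y x y))) (sym (homogeneous-equivariant f y a b c (x · inv y))))
              (eq (x · inv y))
    }
    where
    open Primitive prim
    B′ : El G → El G → IndFun G
    B′ a b = act G (inv y) (B (y · a) (y · b))
    move : ∀ g a → y · (g · a) ≡ ((y · g) · inv y) · (y · a)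
    move g a = sym (trans (assoc _ _ _) (trans (cong ((y · g) ·_) (x⁻¹xy y a)) (assoc y g a)))
    point : ∀ g x → (x · inv y) · ((y · g) · inv y) ≡ (x · g) · inv y
    point g x = trans (sym (assoc _ _ _)) (cong (_· inv y) (trans (assoc _ _ _) (cong (x ·_) (x⁻¹xy y g))))

  -- A P-equivariant retraction r : G → P is chain homotopic to the identity of the standard
  -- resolution; the prism terms F(r a, a, b) − F(r a, r b, b) are this homotopy.
  toPrimitive : ∀ {P f} → IsSubgroup G P → IsHInv2 G H f → IsCocycle2 G f →
                IsCoboundaryOn G H P f → Primitive (_∈ P) f
  toPrimitive {P} {f} P≤ inv-f coc (c , inv-c , eq) = record
    { B           = B
    ; B-HInv      = λ a b h x h∈ → cong₂ _-_ (cong₂ _+_ (b-HInv (r a) (r b) h x h∈) (F-HInv (r a) a b h x h∈)) (F-HInv (r a) (r b) b h x h∈)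
    ; equivariant = λ p a b p∈ → 0ℤ , λ x → trans (B-equivariant p a b p∈ x) (sym (ℤₚ.+-identityʳ _))
    ; coboundary  = λ u v w →
        -- The three simplices of the prism over (u, v, w), with alternating signs, express F(u, v,
        -- w) - F(r u, r v, r w) by prism terms; all arguments of the second F lie in P, where it is
        -- the coboundary of `b`.
        let (κ₁ , E₁) = homogeneous-cocycle {f} coc (r u) u v w
            (κ₂ , E₂) = homogeneous-cocycle {f} coc (r u) (r v) v w
            (κ₃ , E₃) = homogeneous-cocycle {f} coc (r u) (r v) (r w) w
            (κ₄ , E₄) = b-coboundary (retract-∈ u) (retract-∈ v) (retract-∈ w)
        in ((κ₁ - κ₂) + κ₃) + κ₄ , λ x → algebra
             (F u v w x) (F (r u) v w x) (F (r u) u w x) (F (r u) u v x) κ₁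
             (F (r v) v w x) (F (r u) (r v) w x) (F (r u) (r v) v x) κ₂
             (F (r v) (r w) w x) (F (r u) (r w) w x) (F (r u) (r v) (r w) x) κ₃
             (b (r v) (r w) x) (b (r u) (r w) x) (b (r u) (r v) x) κ₄
             (E₁ x) (E₂ x) (E₃ x) (E₄ x)
    }
    where
    open Subgroup P≤
    F = homogeneous f
    r = retract
    b : El G → El G → IndFun G
    b p q x = c (inv p · q) (x · p)
    B : El G → El G → IndFun G
    B a a′ x = (b (r a) (r a′) x + F (r a) a a′ x) - F (r a) (r a′) a′ x
    b-HInv : ∀ p q → HInv (b p q)
    b-HInv p q = act-HInv p (inv-c (inv p · q))
    F-HInv : ∀ p q s → HInv (F p q s)
    F-HInv p q s = act-HInv p (inv-f (inv p · q) (inv q · s))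
    b-equivariant : ∀ g p q x → b (g · p) (g · q) x ≡ b p q (x · g)
    b-equivariant g p q x = cong₂ c ([gx]⁻¹gy g p q) (sym (assoc x g p))
    B-equivariant : ∀ p a a′ → p ∈ P → ∀ x → B (p · a) (p · a′) x ≡ B a a′ (x · p)
    B-equivariant p a a′ p∈ x = trans
      (cong₂ (λ s t → (b s t x + F s (p · a) (p · a′) x) - F s t (p · a′) x) (retract-· a p∈) (retract-· a′ p∈))
      (cong₂ _-_ (cong₂ _+_ (b-equivariant p (r a) (r a′) x) (homogeneous-equivariant f p (r a) a a′ x))
                 (homogeneous-equivariant f p (r a) (r a′) a′ x))
    b-coboundary : ∀ {p q s} → p ∈ P → q ∈ P → s ∈ P →
                   ∃ λ κ → ∀ x → F p q s x ≡ ((b q s x - b p s x) + b p q x) + κ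
    b-coboundary {p} {q} {s} p∈ q∈ s∈ = let (κ , E) = eq (inv p · q) (inv q · s) (·∈ (inv∈ p∈) q∈) (·∈ (inv∈ q∈) s∈) in
      κ , λ x → trans (E (x · p)) (cong (λ i → (i + b p q x) + κ)
        (cong₂ _-_ (cong (c (inv q · s)) (trans (assoc x p _) (cong (x ·_) (xx⁻¹y p q))))
                   (cong (λ u → c u (x · p)) (telescope p q s))))
    algebra : ∀ f₁ f₂ f₃ f₄ κ₁ f₅ f₆ f₇ κ₂ f₈ f₉ f₁₀ κ₃ b₁ b₂ b₃ κ₄ →
      ((f₁ - f₂) + f₃) - f₄ ≡ κ₁ → ((f₅ - f₂) + f₆) - f₇ ≡ κ₂ → ((f₈ - f₉) + f₆) - f₁₀ ≡ κ₃ →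
      f₁₀ ≡ ((b₁ - b₂) + b₃) + κ₄ →
      f₁ ≡ ((((b₁ + f₅) - f₈) - ((b₂ + f₃) - f₉)) + ((b₃ + f₄) - f₇)) + (((κ₁ - κ₂) + κ₃) + κ₄)
    algebra f₁ f₂ f₃ f₄ _ f₅ f₆ f₇ _ f₈ f₉ _ _ b₁ b₂ b₃ κ₄ refl refl refl refl =
      lemma f₁ f₂ f₃ f₄ f₅ f₆ f₇ f₈ f₉ b₁ b₂ b₃ κ₄
      where
      lemma : ∀ f₁ f₂ f₃ f₄ f₅ f₆ f₇ f₈ f₉ b₁ b₂ b₃ κ₄ →
        f₁ ≡ ((((b₁ + f₅) - f₈) - ((b₂ + f₃) - f₉)) + ((b₃ + f₄) - f₇))
             + ((((((f₁ - f₂) + f₃) - f₄) - (((f₅ - f₂) + f₆) - f₇)) + (((f₈ - f₉) + f₆) - (((b₁ - b₂) + b₃) + κ₄))) + κ₄)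
      lemma = solve-∀

  -- Sum of the translates s·B over representatives s of S/P.
  transfer : ∀ {P S f} (P≤ : IsSubgroup G P) (S≤ : IsSubgroup G S) (P⊆S : P ⊆ S) →
             Primitive (_∈ P) f → Primitive (_∈ S) (scale G (Coset.index P≤ S≤ P⊆S) f)
  transfer {P} {S} {f} P≤ S≤ P⊆S prim = record
    { B           = B′
    ; B-HInv      = λ a b h x h∈ → ∑-cong (allFin order) (λ s → cong (⟦ repIn? s ⟧ *_)
                      (act-HInv s (B-HInv (inv s · a) (inv s · b)) h x h∈))
    -- Each summand is equivariant only up to a constant depending on s. Differences of values at
    -- two points are free of these constants; the constant for the whole sum is then read off at
    -- the point `e`.
    ; equivariant = λ g a b g∈ → B′ (g · a) (g · b) e - B′ a b (e · g) , λ x →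
        algebra (B′ (g · a) (g · b) x) (B′ (g · a) (g · b) e) (B′ a b (x · g)) (B′ a b (e · g)) (two-point g a b g∈ x e)
    ; coboundary  = λ a b c → ∑G (λ s → ⟦ repIn? s ⟧ * proj₁ (E a b c s)) , λ x → begin
        + index * F a b c x
          ≡⟨ cong (_* F a b c x) (sym ∑-repIn) ⟩
        ∑G (λ s → ⟦ repIn? s ⟧) * F a b c x
          ≡⟨ sym (∑-*ʳ (allFin order) (F a b c x) (λ s → ⟦ repIn? s ⟧)) ⟩
        ∑G (λ s → ⟦ repIn? s ⟧ * F a b c x)
          ≡⟨ ∑-cong (allFin order) (λ s → trans (cong (⟦ repIn? s ⟧ *_) (proj₂ (E a b c s) x))
               (distrib ⟦ repIn? s ⟧ (β b c x s) (β a c x s) (β a b x s) (proj₁ (E a b c s)))) ⟩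
        ∑G (λ s → ((⟦ repIn? s ⟧ * β b c x s - ⟦ repIn? s ⟧ * β a c x s) + ⟦ repIn? s ⟧ * β a b x s) + ⟦ repIn? s ⟧ * proj₁ (E a b c s))
          ≡⟨ ∑-+ (allFin order) _ (λ s → ⟦ repIn? s ⟧ * proj₁ (E a b c s)) ⟩
        ∑G (λ s → (⟦ repIn? s ⟧ * β b c x s - ⟦ repIn? s ⟧ * β a c x s) + ⟦ repIn? s ⟧ * β a b x s) + ∑G (λ s → ⟦ repIn? s ⟧ * proj₁ (E a b c s))
          ≡⟨ cong (_+ ∑G (λ s → ⟦ repIn? s ⟧ * proj₁ (E a b c s))) (trans (∑-+ (allFin order) _ (λ s → ⟦ repIn? s ⟧ * β a b x s))
               (cong (_+ B′ a b x) (∑-− (allFin order) (λ s → ⟦ repIn? s ⟧ * β b c x s) (λ s → ⟦ repIn? s ⟧ * β a c x s)))) ⟩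
        ((B′ b c x - B′ a c x) + B′ a b x) + ∑G (λ s → ⟦ repIn? s ⟧ * proj₁ (E a b c s)) ∎
    }
    where
    open ≡-Reasoning
    open Primitive prim
    open Coset P≤ S≤ P⊆S
    module P = Subgroup P≤
    F = homogeneous f
    β : El G → El G → El G → El G → ℤ
    β a b x s = B (inv s · a) (inv s · b) (x · s)
    B′ : El G → El G → IndFun G
    B′ a b x = ∑G (λ s → ⟦ repIn? s ⟧ * β a b x s)
    E : ∀ a b c s → F a b c ≈ (λ x → (β b c x s - β a c x s) + β a b x s)
    E a b c s = let (κ , eq) = coboundary (inv s · a) (inv s · b) (inv s · c) in κ , λ x →
      trans (sym (trans (sym (homogeneous-equivariant f s (inv s · a) (inv s · b) (inv s · c) x))
                        (trans (cong₂ (λ u v → F u v (s · (inv s · c)) x) (xx⁻¹y s a) (xx⁻¹y s b)) (cong (λ w → F a b w x) (xx⁻¹y s c)))))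
            (eq (x · s))
    distrib : ∀ k a b c d → k * (((a - b) + c) + d) ≡ ((k * a - k * b) + k * c) + k * d
    distrib = solve-∀
    algebra : ∀ i j k l → i - j ≡ k - l → i ≡ k + (j - l)
    algebra i j k l eq = ≡-from-difference (lemma i j k l) (i-j≡0 eq)
      where
      lemma : ∀ i j k l → i - (k + (j - l)) ≡ (i - j) - (k - l)
      lemma = solve-∀
    -- Replacing s by sp shifts β by a constant independent of the point, so the difference is a
    -- function on S/P and `∑-reps-translate` applies to it.
    β-invariant : ∀ a b x y s p → p ∈ P → β a b x (s · p) - β a b y (s · p) ≡ β a b x s - β a b y s
    β-invariant a b x y s p p∈ = let (κ , eq) = equivariant (inv p) (inv s · a) (inv s · b) (P.inv∈ p∈) in
      trans (cong₂ _-_ (shift κ eq x) (shift κ eq y)) (lemma (β a b x s) (β a b y s) κ)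
      where
      lemma : ∀ i j κ → (i + κ) - (j + κ) ≡ i - j
      lemma = solve-∀
      inv-sp : ∀ a → inv (s · p) · a ≡ inv p · (inv s · a)
      inv-sp a = trans (cong (_· a) (inv-· s p)) (assoc _ _ _)
      shift : ∀ κ → (∀ x → B (inv p · (inv s · a)) (inv p · (inv s · b)) x ≡ B (inv s · a) (inv s · b) (x · inv p) + κ) →
              ∀ x → β a b x (s · p) ≡ β a b x s + κ
      shift κ eq x = trans (cong₂ (λ u v → B u v (x · (s · p))) (inv-sp a) (inv-sp b))
        (trans (eq (x · (s · p))) (cong (λ z → B (inv s · a) (inv s · b) z + κ) (trans (cong (_· inv p) (sym (assoc x s p))) (xyy⁻¹ (x · s) p))))
    two-point : ∀ g a b → g ∈ S → ∀ x y → B′ (g · a) (g · b) x - B′ (g · a) (g · b) y ≡ B′ a b (x · g) - B′ a b (y · g)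
    two-point g a b g∈ x y = begin
      B′ (g · a) (g · b) x - B′ (g · a) (g · b) y        ≡⟨ combine (β (g · a) (g · b) x) (β (g · a) (g · b) y) ⟩
      ∑G (λ s → ⟦ repIn? s ⟧ * φ s)                      ≡⟨ sym (∑-reps-translate φ (β-invariant (g · a) (g · b) x y) g∈) ⟩
      ∑G (λ s → ⟦ repIn? s ⟧ * φ (g · s))                ≡⟨ ∑-cong (allFin order) (λ s → cong (⟦ repIn? s ⟧ *_) (cong₂ _-_ (moved s x) (moved s y))) ⟩
      ∑G (λ s → ⟦ repIn? s ⟧ * (β a b (x · g) s - β a b (y · g) s)) ≡⟨ sym (combine (β a b (x · g)) (β a b (y · g))) ⟩
      B′ a b (x · g) - B′ a b (y · g)                    ∎
      where
      φ : El G → ℤ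
      φ s = β (g · a) (g · b) x s - β (g · a) (g · b) y s
      combine : ∀ (ψ χ : El G → ℤ) → ∑G (λ s → ⟦ repIn? s ⟧ * ψ s) - ∑G (λ s → ⟦ repIn? s ⟧ * χ s) ≡ ∑G (λ s → ⟦ repIn? s ⟧ * (ψ s - χ s))
      combine ψ χ = sym (trans (∑-cong (allFin order) (λ s → lemma ⟦ repIn? s ⟧ (ψ s) (χ s))) (∑-− (allFin order) (λ s → ⟦ repIn? s ⟧ * ψ s) (λ s → ⟦ repIn? s ⟧ * χ s)))
        where
        lemma : ∀ k i j → k * (i - j) ≡ k * i - k * j
        lemma = solve-∀
      moved : ∀ s x → β (g · a) (g · b) x (g · s) ≡ β a b (x · g) s
      moved s x = trans (cong₂ (λ u v → B u v (x · (g · s))) ([gx]⁻¹gy g s a) ([gx]⁻¹gy g s b))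
                        (cong (B (inv s · a) (inv s · b)) (sym (assoc x g s)))

-- Cyclic subgroups

-- A nonzero subgroup of ℤ, seen through its non-negative elements, with its positive generator. It
-- serves for the order of an element and for the stabilizer of a coset H x in ⟨g⟩.
record Period (Q : ℕ → Set) : Set where
  field
    period   : ℕ
    period≢0 : period ≢ 0
    ∣-intro  : ∀ {i} → Q i → period ∣ i
    ∣-elim   : ∀ {i} → period ∣ i → Q i

abstract
  -- Descend to the least positive element; division with remainder shows that it generates.
  findPeriod : ∀ {Q : ℕ → Set} → (∀ i → Dec (Q i)) → Q 0 → (∀ {i j} → Q i → Q j → Q (i ℕ.+ j)) →
               (∀ {i j} → Q i → Q (i ℕ.+ j) → Q j) → ∀ n → n ≢ 0 → Q n → Period Q
  findPeriod {Q} Q? Q0 Q+ Q- n = search n (<-wellFounded n)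
    where
    multiple : ∀ {d} → Q d → ∀ q → Q (q ℕ.* d)
    multiple Qd zero    = Q0
    multiple Qd (suc q) = Q+ Qd (multiple Qd q)
    search : ∀ n → Acc ℕ._<_ n → n ≢ 0 → Q n → Period Q
    search n (acc rec) n≢0 Qn with Finₚ.any? {n} (λ i → ¬? (toℕ i ℕ.≟ 0) ×-dec Q? (toℕ i))
    ... | yes (i , i≢0 , Qi) = search (toℕ i) (rec (Finₚ.toℕ<n i)) i≢0 Qi
    ... | no minimal = record
      { period   = n
      ; period≢0 = n≢0
      ; ∣-intro  = intro
      ; ∣-elim   = λ { (divides q refl) → multiple Qn q }
      }
      where
      instance
        n-nonZero : ℕ.NonZero n
        n-nonZero = ℕ.≢-nonZero n≢0
      intro : ∀ {i} → Q i → n ∣ i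
      intro {i} Qi with i % n ℕ.≟ 0
      ... | yes eq = divides (i / n) (trans (m≡m%n+[m/n]*n i n) (cong (ℕ._+ i / n ℕ.* n) eq))
      ... | no r≢0 = ⊥-elim (minimal (fromℕ< (m%n<n i n) , subst (λ r → r ≢ 0 × Q r) (sym (Finₚ.toℕ-fromℕ< (m%n<n i n)))
            (r≢0 , Q- (multiple Qn (i / n)) (subst Q (trans (m≡m%n+[m/n]*n i n) (ℕₚ.+-comm (i % n) _)) Qi))))

-- The difference j - i is a multiple of d below d. The common complement `l`, in practice the
-- exponent of an inverse power, expresses congruence without subtraction.
≤-mod : ∀ {d i j} → i ℕ.≤ j → j ℕ.< d → ∀ l → d ∣ i ℕ.+ l → d ∣ j ℕ.+ l → i ≡ j
≤-mod {d} {i} i≤j j<d l d∣i d∣j with ℕₚ.m≤n⇒∃[o]m+o≡n i≤j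
... | zero  , refl = sym (ℕₚ.+-identityʳ i)
... | suc o , refl = ⊥-elim (ℕₚ.<⇒≱ (ℕₚ.≤-<-trans (ℕₚ.m≤n+m (suc o) i) j<d)
    (ℕ∣.∣⇒≤ (ℕ∣.∣m+n∣m⇒∣n (subst (d ∣_) rearrange d∣j) d∣i)))
  where
  rearrange : i ℕ.+ suc o ℕ.+ l ≡ i ℕ.+ l ℕ.+ suc o
  rearrange = trans (ℕₚ.+-assoc i (suc o) l) (trans (cong (i ℕ.+_) (ℕₚ.+-comm (suc o) l)) (sym (ℕₚ.+-assoc i l (suc o))))

≡-mod : ∀ {d i j} → i ℕ.< d → j ℕ.< d → ∀ l → d ∣ i ℕ.+ l → d ∣ j ℕ.+ l → i ≡ j
≡-mod {d} {i₀} {j₀} i<d j<d l d∣i d∣j with ℕₚ.≤-total i₀ j₀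
... | inj₁ i≤j = ≤-mod i≤j j<d l d∣i d∣j
... | inj₂ j≤i = sym (≤-mod j≤i i<d l d∣j d∣i)
module Powers (G : FinGroup) where
  open GroupLemmas G

  pow-+ : ∀ g i j → pow G g (i ℕ.+ j) ≡ pow G g i · pow G g j
  pow-+ g zero    j = sym (idˡ _)
  pow-+ g (suc i) j = trans (cong (g ·_) (pow-+ g i j)) (sym (assoc _ _ _))

  pow-pow : ∀ g i j → pow G (pow G g i) j ≡ pow G g (j ℕ.* i)
  pow-pow g i zero    = refl
  pow-pow g i (suc j) = trans (cong (pow G g i ·_) (pow-pow g i j)) (sym (pow-+ g i (j ℕ.* i)))

  pow-1 : ∀ g → pow G g 1 ≡ g
  pow-1 g = idʳ g

  pow-suc : ∀ g i → pow G g (suc i) ≡ pow G g i · g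
  pow-suc g i = trans (cong (pow G g) (ℕₚ.+-comm 1 i)) (trans (pow-+ g i 1) (cong (pow G g i ·_) (pow-1 g)))

  pow-conj : ∀ y g i → pow G ((y · g) · inv y) i ≡ (y · pow G g i) · inv y
  pow-conj y g zero    = sym (trans (cong (_· inv y) (idʳ y)) (invʳ y))
  pow-conj y g (suc i) = trans (cong (((y · g) · inv y) ·_) (pow-conj y g i))
    (trans (sym (assoc _ _ _)) (cong (_· inv y) (trans (assoc _ _ _)
      (trans (cong ((y · g) ·_) (x⁻¹xy y (pow G g i))) (assoc y g (pow G g i))))))

  Order : El G → Set
  Order g = Period (λ i → pow G g i ≡ e)

  order-of : ∀ g → Order g
  order-of g with Finₚ.pigeonhole {order} {suc order} ℕₚ.≤-refl (λ i → pow G g (toℕ i))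
  ... | i , j , i<j , eq with ℕₚ.m≤n⇒∃[o]m+o≡n (ℕₚ.<⇒≤ i<j)
  ... | k , i+k≡j = findPeriod (λ i → pow G g i Finₚ.≟ e) refl
      (λ {a} {b} p q → trans (pow-+ g a b) (trans (cong₂ _·_ p q) (idˡ e)))
      (λ {a} {b} p q → trans (sym (idˡ _)) (trans (cong (_· pow G g b) (sym p)) (trans (sym (pow-+ g a b)) q)))
      k (λ { refl → ℕₚ.<⇒≢ i<j (trans (sym (ℕₚ.+-identityʳ (toℕ i))) i+k≡j) })
      (·-cancelˡ (pow G g (toℕ i)) _ _ (trans (sym (pow-+ g (toℕ i) k)) (trans (cong (pow G g) i+k≡j) (trans (sym eq) (sym (idʳ _))))))

  IsPower : El G → El G → Set
  IsPower g u = ∃ λ k → u ≡ pow G g k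

  module _ {g : El G} (ord : Order g) where
    open Period ord renaming (period to n)
    private instance _ = ℕ.≢-nonZero period≢0

    pow-n* : ∀ q → pow G g (q ℕ.* n) ≡ e
    pow-n* q = ∣-elim (divides q refl)

    pow-% : ∀ i → pow G g (i % n) ≡ pow G g i
    pow-% i = sym (trans (cong (pow G g) (m≡m%n+[m/n]*n i n)) (trans (pow-+ g (i % n) _)
      (trans (cong (pow G g (i % n) ·_) (pow-n* (i / n))) (idʳ _))))

    anyPower? : ∀ {R : El G → Set} → (∀ u → Dec (R u)) → Dec (∃ λ k → R (pow G g k))
    anyPower? {R} R? = map′ (λ (i , r) → toℕ i , r)
      (λ (k , r) → fromℕ< (m%n<n k n) , subst R (sym (trans (cong (pow G g) (Finₚ.toℕ-fromℕ< (m%n<n k n))) (pow-% k))) r)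
      (Finₚ.any? {n} (λ i → R? (pow G g (toℕ i))))

    inv-pow : ∀ i → ∃ λ j → inv (pow G g i) ≡ pow G g j
    inv-pow i = i ℕ.* ℕ.pred n , ·-cancelˡ (pow G g i) _ _ (trans (invʳ _) (sym (trans (sym (pow-+ g i _))
      (trans (cong (pow G g) (trans (sym (ℕₚ.*-suc i (ℕ.pred n))) (cong (i ℕ.*_) (ℕₚ.suc-pred n)))) (pow-n* i)))))

    isPower? : ∀ u → Dec (IsPower g u)
    isPower? u = anyPower? (u Finₚ.≟_)

    generated : Sub G
    generated = ⟪ isPower? ⟫

    generated-subgroup : IsSubgroup G generated
    generated-subgroup = ∈⟪⟫⁺ isPower? (0 , refl)
      , (λ x y x∈ y∈ → let (i , x≡) = ∈⟪⟫⁻ isPower? x∈ ; (j , y≡) = ∈⟪⟫⁻ isPower? y∈ in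
           ∈⟪⟫⁺ isPower? (i ℕ.+ j , trans (cong₂ _·_ x≡ y≡) (sym (pow-+ g i j))))
      , (λ x x∈ → let (i , x≡) = ∈⟪⟫⁻ isPower? x∈ ; (j , eq) = inv-pow i in
           ∈⟪⟫⁺ isPower? (j , trans (cong inv x≡) eq))

    generated-cyclic : IsCyclicSubgroup G generated
    generated-cyclic = g , (λ x → ∈⟪⟫⁻ isPower?) , (λ k → ∈⟪⟫⁺ isPower? (k , refl))

    pow-injective : ∀ {i j} → i ℕ.< n → j ℕ.< n → pow G g i ≡ pow G g j → i ≡ j
    pow-injective {i} {j} i<n j<n eq = ≡-mod i<n j<n (proj₁ (inv-pow i))
      (∣-intro (trans (pow-+ g i _) (trans (cong (pow G g i ·_) (sym (proj₂ (inv-pow i)))) (invʳ _))))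
      (∣-intro (trans (pow-+ g j _) (trans (cong₂ _·_ (sym eq) (sym (proj₂ (inv-pow i)))) (invʳ _))))

    ∣generated∣ : ∣ generated ∣ ≡ n
    ∣generated∣ = ℤₚ.+-injective (begin
      + ∣ generated ∣
        ≡⟨ ∣∣-∑ generated ⟩
      ∑G (λ x → ⟦ x ∈? generated ⟧)
        ≡⟨ ∑-cong (allFin order) fibre ⟩
      ∑G (λ x → ∑ (upTo n) (λ i → ⟦ pow G g i Finₚ.≟ x ⟧))
        ≡⟨ ∑-swap (allFin order) (upTo n) _ ⟩
      ∑ (upTo n) (λ i → ∑G (λ x → ⟦ pow G g i Finₚ.≟ x ⟧))
        ≡⟨ ∑-cong (upTo n) (λ i → trans (∑-cong (allFin order) (λ x → sym (ℤₚ.*-identityʳ ⟦ pow G g i Finₚ.≟ x ⟧))) (∑G-δ (pow G g i) (λ _ → 1ℤ))) ⟩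
      ∑ (upTo n) (λ _ → 1ℤ)
        ≡⟨ ∑-length (upTo n) ⟩
      + length (upTo n)
        ≡⟨ cong +_ (Listₚ.length-upTo n) ⟩
      + n ∎)
      where
      open ≡-Reasoning
      fibre : ∀ x → ⟦ x ∈? generated ⟧ ≡ ∑ (upTo n) (λ i → ⟦ pow G g i Finₚ.≟ x ⟧)
      fibre x with x ∈? generated
      ... | no x∉ = sym (trans (∑-cong (upTo n) (λ i → ⟦⟧-false (pow G g i Finₚ.≟ x) (λ eq → x∉ (∈⟪⟫⁺ isPower? (i , sym eq))))) (∑-zero (upTo n)))
      ... | yes x∈ with ∈⟪⟫⁻ isPower? x∈
      ...   | k , refl = sym (trans
              (∑-cong-∈ (upTo n) (λ i i∈ → trans (⟦⟧-cong (pow G g i Finₚ.≟ pow G g k) (k % n ℕ.≟ i)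
                 (λ eq → pow-injective (m%n<n k n) (∈ₗ.∈-upTo⁻ i∈) (trans (pow-% k) (sym eq)))
                 (λ eq → trans (cong (pow G g) (sym eq)) (pow-% k)))
                 (sym (ℤₚ.*-identityʳ ⟦ k % n ℕ.≟ i ⟧))))
              (∑-δ ℕ._≟_ (Uniqueₚ.upTo⁺ n) (∈ₗ.∈-upTo⁺ (m%n<n k n)) (λ _ → 1ℤ)))

  -- This makes the split into cyclic and non-cyclic members of `𝒟` constructive; the condition on
  -- all exponents is decided by searching one period for a counterexample.
  isCyclic? : ∀ S → Dec (∃ λ g → (∀ x → x ∈ S → IsPower g x) × (∀ k → pow G g k ∈ S))
  isCyclic? S = Finₚ.any? (λ g → Finₚ.all? (λ x → (x ∈? S) →-dec isPower? (order-of g) x) ×-dec allPowers? g)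
    where
    allPowers? : ∀ g → Dec (∀ k → pow G g k ∈ S)
    allPowers? g = map′ (λ ∄ k → decidable-stable (pow G g k ∈? S) (λ ∉ → ∄ (k , ∉))) (λ all (k , ∉) → ∉ (all k))
                        (¬? (anyPower? (order-of g) (λ u → ¬? (u ∈? S))))

-- Cohomology of cyclic subgroups

module CyclicCohomology (G : FinGroup) (H : Sub G) where
  open GroupLemmas G
  open Cochains G H
  open Powers G

  module Fixed (g : El G) (ord : Order g) where
    open Period ord renaming (period to n)

    infix 30 g^_
    g^_ : ℕ → El G
    g^ i = pow G g i

    g^n : g^ n ≡ e
    g^n = ∣-elim ℕ∣.∣-refl

    g^[n+_] : ∀ i → g^ (n ℕ.+ i) ≡ g^ i
    g^[n+ i ] = trans (pow-+ g n i) (trans (cong (_· g^ i) g^n) (idˡ _))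

    -- The operator 1 + g + ... + gⁱ⁻¹: the norm of ⟨g⟩ for i = n, and as a function of i the
    -- 1-cocycle on ℕ with value b at 1.
    norm : ℕ → IndFun G → IndFun G
    norm i b x = ∑< i (λ j → b (x · g^ j))

    norm-HInv : ∀ i {b} → HInv b → HInv (norm i b)
    norm-HInv i inv-b h x h∈ = ∑<-cong i (λ j → act-HInv (g^ j) inv-b h x h∈)

    norm-+ : ∀ i j b x → norm (i ℕ.+ j) b x ≡ norm i b x + norm j b (x · g^ i)
    norm-+ i j b x = trans (∑<-split i j _) (cong (_+_ (norm i b x))
      (∑<-cong j (λ k → cong b (trans (cong (x ·_) (pow-+ g i k)) (sym (assoc _ _ _))))))

    module Cocycle (f : Cochain2 G) (inv-f : IsHInv2 G H f) (coc : IsCocycle2 G f) where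

      -- E n represents the class of f under H²(⟨g⟩, J) ≅ J^⟨g⟩ / N J.
      E : ℕ → IndFun G
      E i x = ∑< i (λ j → f (g^ j) g x)

      E-HInv : ∀ i → HInv (E i)
      E-HInv i h x h∈ = ∑<-cong i (λ j → inv-f (g^ j) g h x h∈)

      E-n+ : ∀ i x → E (n ℕ.+ i) x ≡ E n x + E i x
      E-n+ i x = trans (∑<-split n i _) (cong (_+_ (E n x)) (∑<-cong i (λ j → cong (λ u → f u g x) g^[n+ j ])))

      -- f is not assumed normalised; the term f(e, e) is the value at 0 that the cocycle identity
      -- at (gⁱ, e, e) forces up to a constant.
      c : ℕ → IndFun G
      c i x = f e e x - E i x

      c-HInv : ∀ i → HInv (c i)
      c-HInv i h x h∈ = cong₂ _-_ (inv-f e e h x h∈) (E-HInv i h x h∈)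

      -- f pulled back along i ↦ gⁱ splits, as ℕ is free; only periodicity of c mod n can fail.
      c-coboundary : ∀ i j → f (g^ i) (g^ j) ≈ (λ x → (c j (x · g^ i) - c (i ℕ.+ j) x) + c i x)
      c-coboundary i zero = let (κ , eq) = coc (g^ i) e e in - κ , λ x →
        trans (algebra (f e e (x · g^ i)) (f (g^ i) e x) κ (trans
                 (sym (cong₂ (λ u v → ((f e e (x · g^ i) - f u e x) + f (g^ i) v x) - f (g^ i) e x) (idʳ (g^ i)) (idʳ e))) (eq x)))
              (sym (trans (cong (λ k → ((c 0 (x · g^ i) - c k x) + c i x) + - κ) (ℕₚ.+-identityʳ i)) (cancel (f e e (x · g^ i)) (c i x) κ)))
        where
        algebra : ∀ a b κ → ((a - b) + b) - b ≡ 0ℤ + κ → b ≡ a - κ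
        algebra a b κ eq = ≡-from-difference (lemma a b κ) (cong -_ (i-j≡0 eq))
          where
          lemma : ∀ a b κ → b - (a - κ) ≡ - ((((a - b) + b) - b) - (0ℤ + κ))
          lemma = solve-∀
        cancel : ∀ a c κ → (((a - 0ℤ) - c) + c) + - κ ≡ a - κ
        cancel = solve-∀
      c-coboundary i (suc j) = let (κ , ih) = c-coboundary i j ; (κ′ , eq) = coc (g^ i) (g^ j) g in κ + κ′ , λ x →
        trans (cong (λ u → f (g^ i) u x) (pow-suc g j))
        (trans (algebra (f (g^ j) g (x · g^ i)) (f (g^ (i ℕ.+ j)) g x) (f (g^ i) (g^ j · g) x) (f (g^ i) (g^ j) x)
                   (f e e (x · g^ i)) (E j (x · g^ i)) (f e e x) (E (i ℕ.+ j) x) (c i x) κ κ′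
                   (trans (cong (λ u → ((f (g^ j) g (x · g^ i) - f u g x) + f (g^ i) (g^ j · g) x) - f (g^ i) (g^ j) x) (pow-+ g i j)) (eq x))
                   (ih x))
               (cong (λ k → ((c (suc j) (x · g^ i) - c k x) + c i x) + (κ + κ′)) (sym (ℕₚ.+-suc i j))))
        where
        algebra : ∀ a b u v z₁ E₁ z E₂ c κ κ′ → ((a - b) + u) - v ≡ 0ℤ + κ′ → v ≡ (((z₁ - E₁) - (z - E₂)) + c) + κ →
                  u ≡ (((z₁ - (E₁ + a)) - (z - (E₂ + b))) + c) + (κ + κ′)
        algebra a b u v z₁ E₁ z E₂ c κ κ′ p q = ≡-from-difference (lemma a b u v z₁ E₁ z E₂ c κ κ′)
          (cong₂ _+_ (i-j≡0 p) (i-j≡0 q))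
          where
          lemma : ∀ a b u v z₁ E₁ z E₂ c κ κ′ → u - ((((z₁ - (E₁ + a)) - (z - (E₂ + b))) + c) + (κ + κ′)) ≡
                  ((((a - b) + u) - v) - (0ℤ + κ′)) + (v - ((((z₁ - E₁) - (z - E₂)) + c) + κ))
          lemma = solve-∀

      -- gE − E is a constant κ, and n κ = 0 because gⁿ = 1.
      E-invariant : ∀ i x → E n (x · g^ i) ≡ E n x
      E-invariant i x = trans (steps i x) (trans (cong (λ k → E n x + + i * k) κ≡0) (trans (cong (_+_ (E n x)) (ℤₚ.*-zeroʳ (+ i))) (ℤₚ.+-identityʳ _)))
        where
        -- Since gⁿ = e, both instances describe f(g, e); their difference compares E n at x·g with
        -- E n at x.
        κ₁ = proj₁ (c-coboundary 1 n)
        κ₂ = proj₁ (c-coboundary 1 0)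
        κ : ℤ
        κ = κ₁ - κ₂
        algebra : ∀ f c₁ z E′ z₀ E₀ E₁ κ₁ κ₂ →
                  f ≡ (((z - E′) - (z₀ - (E₀ + E₁))) + c₁) + κ₁ → f ≡ (((z - 0ℤ) - (z₀ - E₁)) + c₁) + κ₂ →
                  E′ ≡ E₀ + (κ₁ - κ₂)
        algebra f c₁ z E′ z₀ E₀ E₁ κ₁ κ₂ p q = ≡-from-difference (lemma f c₁ z E′ z₀ E₀ E₁ κ₁ κ₂) (cong₂ _-_ (i-j≡0 p) (i-j≡0 q))
          where
          lemma : ∀ f c₁ z E′ z₀ E₀ E₁ κ₁ κ₂ → E′ - (E₀ + (κ₁ - κ₂)) ≡
                  (f - ((((z - E′) - (z₀ - (E₀ + E₁))) + c₁) + κ₁)) - (f - ((((z - 0ℤ) - (z₀ - E₁)) + c₁) + κ₂))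
          lemma = solve-∀
        step : ∀ x → E n (x · g^ 1) ≡ E n x + κ
        step x = algebra (f (g^ 1) e x) (c 1 x) (f e e (x · g^ 1)) (E n (x · g^ 1)) (f e e x) (E n x) (E 1 x) κ₁ κ₂
          (trans (cong (λ u → f (g^ 1) u x) (sym g^n)) (trans (proj₂ (c-coboundary 1 n) x)
            (cong (λ k → ((c n (x · g^ 1) - (f e e x - k)) + c 1 x) + κ₁) (trans (cong (λ k → E k x) (ℕₚ.+-comm 1 n)) (E-n+ 1 x)))))
          (proj₂ (c-coboundary 1 0) x)
        steps : ∀ i x → E n (x · g^ i) ≡ E n x + + i * κ
        steps zero    x = trans (cong (E n) (idʳ x)) (sym (ℤₚ.+-identityʳ _))
        steps (suc i) x = trans (cong (E n) (trans (cong (λ u → x · (u · g^ i)) (sym (pow-1 g))) (sym (assoc _ _ _))))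
          (trans (steps i (x · g^ 1)) (trans (cong (_+ + i * κ) (step x)) (lemma (E n x) κ (+ i))))
          where
          lemma : ∀ a k i → (a + k) + i * k ≡ a + (1ℤ + i) * k
          lemma = solve-∀
        nκ≡0 : + n * κ ≡ 0ℤ
        nκ≡0 = ≡-from-difference (lemma (E n e) (+ n * κ)) (i-j≡0 (trans (sym (steps n e)) (cong (E n) (trans (idˡ (g^ n)) g^n))))
          where
          lemma : ∀ a k → k - 0ℤ ≡ (a + k) - a
          lemma = solve-∀
        κ≡0 : κ ≡ 0ℤ
        κ≡0 = ℤₚ.*-cancelˡ-≡ (+ n) κ 0ℤ {{ℤ.≢-nonZero (λ eq → period≢0 (ℤₚ.+-injective eq))}} (trans nκ≡0 (sym (ℤₚ.*-zeroʳ (+ n))))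

      -- Adding the 1-cocycle i ↦ `norm i b` to `c` does not change the coboundary. By the
      -- hypothesis on `E n`, a shift of i by n changes the sum only by the constant -T, so modulo
      -- constants it descends from ℕ to ⟨g⟩.
      norm⇒coboundary : ∀ b → HInv b → ∀ T → (∀ x → E n x ≡ T + norm n b x) → CoboundaryOn (IsPower g) f
      norm⇒coboundary b inv-b T E≡ = γ , (λ u → c′-HInv (log u)) , γ-coboundary
        where
        c′ : ℕ → IndFun G
        c′ i x = c i x + norm i b x
        c′-HInv : ∀ i → HInv (c′ i)
        c′-HInv i h x h∈ = cong₂ _+_ (c-HInv i h x h∈) (norm-HInv i inv-b h x h∈)
        c′-n+ : ∀ i x → c′ (n ℕ.+ i) x ≡ c′ i x - T
        c′-n+ i x = trans (cong₂ (λ k l → (f e e x - k) + l) (E-n+ i x)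
            (trans (norm-+ n i b x) (cong (λ y → norm n b x + norm i b y) (trans (cong (x ·_) g^n) (idʳ x)))))
          (trans (cong (λ k → (f e e x - (k + E i x)) + (norm n b x + norm i b x)) (E≡ x))
                 (lemma (f e e x) T (norm n b x) (E i x) (norm i b x)))
          where
          lemma : ∀ z T N E B → (z - ((T + N) + E)) + (N + B) ≡ ((z - E) + B) - T
          lemma = solve-∀
        c′-multiple : ∀ q i → ∃ λ κ → ∀ x → c′ (q ℕ.* n ℕ.+ i) x ≡ c′ i x + κ
        c′-multiple zero    i = 0ℤ , λ x → sym (ℤₚ.+-identityʳ _)
        c′-multiple (suc q) i = let (κ , eq) = c′-multiple q i in κ - T , λ x →
          trans (cong (λ k → c′ k x) (ℕₚ.+-assoc n (q ℕ.* n) i)) (trans (c′-n+ (q ℕ.* n ℕ.+ i) x)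
            (trans (cong (_- T) (eq x)) (ℤₚ.+-assoc (c′ i x) κ (- T))))
        c′-≤ : ∀ {i j} → i ℕ.≤ j → g^ i ≡ g^ j → c′ j ≈ c′ i
        c′-≤ {i} i≤j eq with ℕₚ.m≤n⇒∃[o]m+o≡n i≤j
        ... | o , refl with ∣-intro {o} (sym (·-cancelˡ (g^ i) e (g^ o) (trans (idʳ _) (trans eq (pow-+ g i o)))))
        ... | divides q refl = let (κ , E) = c′-multiple q i in κ , λ x → trans (cong (λ k → c′ k x) (ℕₚ.+-comm i (q ℕ.* n))) (E x)
        c′-cong : ∀ {i j} → g^ i ≡ g^ j → c′ i ≈ c′ j
        c′-cong {i} {j} eq with ℕₚ.≤-total i j
        ... | inj₂ j≤i = c′-≤ j≤i (sym eq)
        ... | inj₁ i≤j = let (κ , E) = c′-≤ i≤j eq in - κ , λ x → ≡-from-difference (lemma (c′ i x) (c′ j x) κ) (cong -_ (i-j≡0 (E x)))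
          where
          lemma : ∀ a b κ → a - (b + - κ) ≡ - (b - (a + κ))
          lemma = solve-∀
        log : El G → ℕ
        log u with isPower? ord u
        ... | yes (k , _) = k
        ... | no _        = 0
        log-pow : ∀ {u} k → u ≡ g^ k → g^ k ≡ g^ (log u)
        log-pow {u} k u≡ with isPower? ord u
        ... | yes (l , u≡′) = trans (sym u≡) u≡′
        ... | no ∄          = ⊥-elim (∄ (k , u≡))
        γ : Cochain1 G
        γ u = c′ (log u)
        γ-pow : ∀ u k → u ≡ g^ k → c′ k ≈ γ u
        γ-pow u k u≡ = c′-cong {k} {log u} (log-pow k u≡)
        γ-coboundary : ∀ u v → IsPower g u → IsPower g v → f u v ≈ (λ x → (act G u (γ v) x - γ (u · v) x) + γ u x)
        γ-coboundary u v (i , refl) (j , refl) =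
          let (κ , eq)    = c-coboundary i j
              (κ₁ , eq₁) = γ-pow (g^ j) j refl
              (κ₂ , eq₂) = γ-pow (g^ i · g^ j) (i ℕ.+ j) (sym (pow-+ g i j))
              (κ₃ , eq₃) = γ-pow (g^ i) i refl
          in ((κ + κ₁) - κ₂) + κ₃ , λ x → algebra
               (f (g^ i) (g^ j) x) (c j (x · g^ i)) (norm j b (x · g^ i)) (c (i ℕ.+ j) x) (norm i b x) (c i x) κ
               (γ (g^ j) (x · g^ i)) κ₁ (γ (g^ i · g^ j) x) κ₂ (γ (g^ i) x) κ₃
               (eq x) (eq₁ (x · g^ i)) (trans (cong (_+_ (c (i ℕ.+ j) x)) (sym (norm-+ i j b x))) (eq₂ x)) (eq₃ x)
          where
          algebra : ∀ f c₁ b₁ c₂ b₃ c₃ κ γ₁ κ₁ γ₂ κ₂ γ₃ κ₃ →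
            f ≡ ((c₁ - c₂) + c₃) + κ → c₁ + b₁ ≡ γ₁ + κ₁ → c₂ + (b₃ + b₁) ≡ γ₂ + κ₂ → c₃ + b₃ ≡ γ₃ + κ₃ →
            f ≡ ((γ₁ - γ₂) + γ₃) + (((κ + κ₁) - κ₂) + κ₃)
          algebra f c₁ b₁ c₂ b₃ c₃ κ γ₁ κ₁ γ₂ κ₂ γ₃ κ₃ p q r s =
            ≡-from-difference (lemma f c₁ b₁ c₂ b₃ c₃ κ γ₁ κ₁ γ₂ κ₂ γ₃ κ₃)
              (cong₂ _+_ (cong₂ _-_ (cong₂ _+_ (i-j≡0 p) (i-j≡0 q)) (i-j≡0 r)) (i-j≡0 s))
            where
            lemma : ∀ f c₁ b₁ c₂ b₃ c₃ κ γ₁ κ₁ γ₂ κ₂ γ₃ κ₃ →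
              f - (((γ₁ - γ₂) + γ₃) + (((κ + κ₁) - κ₂) + κ₃)) ≡
              (((f - (((c₁ - c₂) + c₃) + κ)) + ((c₁ + b₁) - (γ₁ + κ₁))) - ((c₂ + (b₃ + b₁)) - (γ₂ + κ₂))) + ((c₃ + b₃) - (γ₃ + κ₃))
            lemma = solve-∀

      -- Restriction to ⟨gᵈ⟩ is induced by the inclusion of invariants.
      coboundary⇒norm : ∀ m d → n ≡ m ℕ.* d → CoboundaryOn (IsPower (g^ d)) f →
        ∃ λ b → HInv b × ∃ λ T → ∀ x → E n x ≡ T + ∑< m (λ j → b (x · pow G (g^ d) j))
      coboundary⇒norm m d n≡ (γ , inv-γ , γ-cob) = η 1 , η-HInv 1 , κm - κ₀ , λ x →
          algebra (E n x) (η m x) (η 0 x) _ κm κ₀ (E≡ x) (proj₂ (η-norm m) x) (proj₂ (η-norm 0) x)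
        where
        g′ = g^ d
        -- γ and `c` both split f along the powers of gᵈ, so modulo constants their difference is a
        -- 1-cocycle on ℕ, determined by its value at 1.
        η : ℕ → IndFun G
        η i x = γ (pow G g′ i) x - c (i ℕ.* d) x
        η-HInv : ∀ i → HInv (η i)
        η-HInv i h x h∈ = cong₂ _-_ (inv-γ (pow G g′ i) h x h∈) (c-HInv (i ℕ.* d) h x h∈)
        η-+ : ∀ i j → ∃ λ κ → ∀ x → η (i ℕ.+ j) x ≡ (η i x + η j (x · pow G g′ i)) + κ
        η-+ i j =
          let (κ₁ , eq₁) = γ-cob (pow G g′ i) (pow G g′ j) (i , refl) (j , refl)
              (κ₂ , eq₂) = c-coboundary (i ℕ.* d) (j ℕ.* d)
          in κ₁ - κ₂ , λ x → trans
            (cong₂ (λ u k → γ u x - c k x) (pow-+ g′ i j) (ℕₚ.*-distribʳ-+ d i j))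
            (algebra′ (f (pow G g′ i) (pow G g′ j) x) (γ (pow G g′ j) (x · pow G g′ i)) (γ (pow G g′ i · pow G g′ j) x) (γ (pow G g′ i) x) κ₁
                (c (j ℕ.* d) (x · pow G g′ i)) (c (i ℕ.* d ℕ.+ j ℕ.* d) x) (c (i ℕ.* d) x) κ₂ (eq₁ x)
                (trans (cong₂ (λ u v → f u v x) (pow-pow g d i) (pow-pow g d j))
                  (trans (eq₂ x) (cong (λ u → ((c (j ℕ.* d) (x · u) - c (i ℕ.* d ℕ.+ j ℕ.* d) x) + c (i ℕ.* d) x) + κ₂) (sym (pow-pow g d i))))))
          where
          algebra′ : ∀ f γ₁ γ₂ γ₃ κ₁ c₁ c₂ c₃ κ₂ → f ≡ ((γ₁ - γ₂) + γ₃) + κ₁ → f ≡ ((c₁ - c₂) + c₃) + κ₂ →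
                     γ₂ - c₂ ≡ ((γ₃ - c₃) + (γ₁ - c₁)) + (κ₁ - κ₂)
          algebra′ f γ₁ γ₂ γ₃ κ₁ c₁ c₂ c₃ κ₂ p q = ≡-from-difference (lemma f γ₁ γ₂ γ₃ κ₁ c₁ c₂ c₃ κ₂) (cong₂ _-_ (i-j≡0 p) (i-j≡0 q))
            where
            lemma : ∀ f γ₁ γ₂ γ₃ κ₁ c₁ c₂ c₃ κ₂ → (γ₂ - c₂) - (((γ₃ - c₃) + (γ₁ - c₁)) + (κ₁ - κ₂)) ≡
                    (f - (((γ₁ - γ₂) + γ₃) + κ₁)) - (f - (((c₁ - c₂) + c₃) + κ₂))
            lemma = solve-∀
        η-norm : ∀ i → ∃ λ κ → ∀ x → η i x ≡ ∑< i (λ j → η 1 (x · pow G g′ j)) + κ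
        η-norm zero = let (κ , eq) = η-+ 0 0 in - κ , λ x →
          ≡-from-difference (lemma (η 0 x) κ) (cong -_ (i-j≡0 (trans (eq x) (cong (λ y → (η 0 x + η 0 y) + κ) (idʳ x)))))
          where
          lemma : ∀ a κ → a - (0ℤ + - κ) ≡ - (a - ((a + a) + κ))
          lemma = solve-∀
        η-norm (suc i) = let (κ , ih) = η-norm i ; (κ′ , eq) = η-+ i 1 in κ + κ′ , λ x →
          trans (cong (λ k → η k x) (ℕₚ.+-comm 1 i)) (trans (eq x) (trans
            (cong (λ k → (k + η 1 (x · pow G g′ i)) + κ′) (ih x)) (lemma (∑< i (λ j → η 1 (x · pow G g′ j))) κ (η 1 (x · pow G g′ i)) κ′)))
          where
          lemma : ∀ s κ a κ′ → ((s + κ) + a) + κ′ ≡ (s + a) + (κ + κ′)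
          lemma = solve-∀
        κm = proj₁ (η-norm m)
        κ₀ = proj₁ (η-norm 0)
        -- For i = m and for i = 0 the argument of γ is e. So γ cancels, and c 0 - c n = E n
        -- remains.
        E≡ : ∀ x → E n x ≡ η m x - η 0 x
        E≡ x = sym (trans (cong₂ (λ u k → (γ u x - c k x) - η 0 x)
            (trans (pow-pow g d m) (trans (cong g^_ (sym n≡)) g^n)) (sym n≡)) (lemma (γ e x) (f e e x) (E n x)))
          where
          lemma : ∀ γ z E → (γ - (z - E)) - (γ - (z - 0ℤ)) ≡ E
          lemma = solve-∀
        algebra : ∀ a ηm η₀ s κm κ₀ → a ≡ ηm - η₀ → ηm ≡ s + κm → η₀ ≡ 0ℤ + κ₀ → a ≡ (κm - κ₀) + s
        algebra _ _ _ s κm κ₀ refl refl refl = lemma s κm κ₀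
          where
          lemma : ∀ s κm κ₀ → (s + κm) - (0ℤ + κ₀) ≡ (κm - κ₀) + s
          lemma = solve-∀

-- Double cosets of H and ⟨g⟩, and the vanishing criterion on cyclic subgroups

module CyclicCase (G : FinGroup) (H : Sub G) (H≤ : IsSubgroup G H) where
  open GroupLemmas G
  open Cochains G H
  open Powers G
  open CyclicCohomology G H
  open Subgroup H≤ using () renaming (e∈ to e∈H; ·∈ to ·∈H; inv∈ to inv∈H; ·∈⁻ to ·∈H⁻; ·∈⁻ʳ to ·∈H⁻ʳ)

  module Orbits (g : El G) (ord : Order g) where
    open Period ord renaming (period to n)
    open Fixed g ord

    -- Right multiplication by gⁱ fixes the coset H x.
    Fixes : El G → ℕ → Set
    Fixes x i = (x · g^ i) · inv x ∈ H

    move : ∀ x i j → x · g^ (i ℕ.+ j) ≡ ((x · g^ i) · inv x) · (x · g^ j)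
    move x i j = trans (cong (x ·_) (pow-+ g i j)) (trans (sym (assoc _ _ _))
      (trans (cong (_· g^ j) (sym (xy⁻¹y (x · g^ i) x))) (assoc _ _ _)))

    fixes-+ : ∀ x i j → (x · g^ (i ℕ.+ j)) · inv x ≡ ((x · g^ i) · inv x) · ((x · g^ j) · inv x)
    fixes-+ x i j = trans (cong (_· inv x) (move x i j)) (assoc _ _ _)

    fixes-e : ∀ x {u} → u ≡ e → (x · u) · inv x ∈ H
    fixes-e x refl = subst (_∈ H) (sym (trans (cong (_· inv x) (idʳ x)) (invʳ x))) e∈H

    fixes-period : ∀ x → Period (Fixes x)
    fixes-period x = findPeriod (λ i → ((x · g^ i) · inv x) ∈? H) (fixes-e x refl)
      (λ {i} {j} p q → subst (_∈ H) (sym (fixes-+ x i j)) (·∈H p q))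
      (λ {i} {j} p q → ·∈H⁻ p (subst (_∈ H) (fixes-+ x i j) q))
      n period≢0 (fixes-e x g^n)

    -- The length of the orbit of the coset H x under right multiplication by ⟨g⟩.
    d : El G → ℕ
    d x = Period.period (fixes-period x)

    d∣n : ∀ x → d x ∣ n
    d∣n x = Period.∣-intro (fixes-period x) (fixes-e x g^n)

    -- The order of ⟨g⟩ ∩ x⁻¹Hx.
    s : El G → ℕ
    s x = _∣_.quotient (d∣n x)

    n≡s*d : ∀ x → n ≡ s x ℕ.* d x
    n≡s*d x = _∣_.equality (d∣n x)

    s≢0 : ∀ x → s x ≢ 0
    s≢0 x eq = period≢0 (trans (n≡s*d x) (cong (ℕ._* d x) eq))

    return : ∀ {b} → HInv b → ∀ x i j → Fixes x i → b (x · g^ (i ℕ.+ j)) ≡ b (x · g^ j)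
    return {b} inv-b x i j fix = trans (cong b (move x i j)) (inv-b _ (x · g^ j) fix)

    -- Membership of z in the double coset H y ⟨g⟩.
    Double : El G → El G → Set
    Double y z = ∃ λ k → (z · g^ k) · inv y ∈ H

    double? : ∀ y z → Dec (Double y z)
    double? y z = anyPower? ord (λ u → ((z · u) · inv y) ∈? H)

    rep : El G → El G
    rep y = pick ⟪ double? y ⟫ y

    y∈double : ∀ y → y ∈ ⟪ double? y ⟫
    y∈double y = ∈⟪⟫⁺ (double? y) (0 , fixes-e y refl)

    rep-double : ∀ y → Double y (rep y)
    rep-double y = ∈⟪⟫⁻ (double? y) (pick-∈ ⟪ double? y ⟫ y (y∈double y))

    rep-cong : ∀ y y′ → (∀ z → Double y z → Double y′ z) → (∀ z → Double y′ z → Double y z) → rep y ≡ rep y′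
    rep-cong y y′ f g = trans (pick-default ⟪ double? y ⟫ y y′ (y∈double y))
      (cong (λ D → pick D y′) (⊆-antisym (λ {z} z∈ → ∈⟪⟫⁺ (double? y′) (f z (∈⟪⟫⁻ (double? y) z∈)))
                                         (λ {z} z∈ → ∈⟪⟫⁺ (double? y) (g z (∈⟪⟫⁻ (double? y′) z∈)))))

    rep-H : ∀ h y → h ∈ H → rep (h · y) ≡ rep y
    rep-H h y h∈ = rep-cong (h · y) y
      (λ z (k , p) → k , ·∈H⁻ʳ (inv∈H h∈) (subst (_∈ H) (shift (z · g^ k)) p))
      (λ z (k , p) → k , subst (_∈ H) (sym (shift (z · g^ k))) (·∈H p (inv∈H h∈)))
      where
      shift : ∀ w → w · inv (h · y) ≡ (w · inv y) · inv h
      shift w = trans (cong (w ·_) (inv-· h y)) (sym (assoc _ _ _))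

    rep-g^ : ∀ y i → rep (y · g^ i) ≡ rep y
    rep-g^ y i = rep-cong (y · g^ i) y
      (λ z (k , p) → k ℕ.+ proj₁ (inv-pow ord i) , subst (_∈ H) (forth z k) p)
      (λ z (k , p) → k ℕ.+ i , subst (_∈ H) (back z k) p)
      where
      forth : ∀ z k → (z · g^ k) · inv (y · g^ i) ≡ (z · g^ (k ℕ.+ proj₁ (inv-pow ord i))) · inv y
      forth z k = trans (cong ((z · g^ k) ·_) (inv-· y (g^ i))) (trans (sym (assoc _ _ _)) (cong (_· inv y)
        (trans (assoc _ _ _) (cong (z ·_) (trans (cong (g^ k ·_) (proj₂ (inv-pow ord i))) (sym (pow-+ g k _)))))))
      back : ∀ z k → (z · g^ k) · inv y ≡ (z · g^ (k ℕ.+ i)) · inv (y · g^ i)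
      back z k = sym (trans (cong₂ _·_ (trans (cong (z ·_) (pow-+ g k i)) (sym (assoc _ _ _))) (inv-· y (g^ i)))
        (trans (sym (assoc _ _ _)) (cong (_· inv y) (xyy⁻¹ (z · g^ k) (g^ i)))))

    double-invariant : ∀ {φ : IndFun G} → HInv φ → (∀ i x → φ (x · g^ i) ≡ φ x) → ∀ {y z} → Double y z → φ z ≡ φ y
    double-invariant {φ} inv-φ φ-g {y} {z} (k , p) = trans (sym (φ-g k z)) (trans (cong φ (sym (xy⁻¹y (z · g^ k) y))) (inv-φ _ y p))

    -- Conjugation by z gᵏ y⁻¹ ∈ H carries y gⁱ y⁻¹ to z gⁱ z⁻¹, because powers of g commute. Hence
    -- `d` and `s` are constant on double cosets.
    fixes-double : ∀ {y z} i → Double y z → Fixes y i → Fixes z i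
    fixes-double {y} {z} i (k , p) fix = subst (_∈ H) equation (·∈H (·∈H p fix) (inv∈H p))
      where
      w = z · g^ k
      commute : g^ k · g^ i ≡ g^ i · g^ k
      commute = trans (sym (pow-+ g k i)) (trans (cong g^_ (ℕₚ.+-comm k i)) (pow-+ g i k))
      equation : ((w · inv y) · ((y · g^ i) · inv y)) · inv (w · inv y) ≡ (z · g^ i) · inv z
      equation = trans (cong₂ _·_
          (trans (sym (assoc _ _ _)) (cong (_· inv y) (trans (assoc _ _ _) (cong (w ·_) (x⁻¹xy y (g^ i))))))
          (trans (inv-· w (inv y)) (cong (_· inv w) (inv-inv y))))
        (trans (sym (assoc _ _ _)) (trans (cong (_· inv w) (xy⁻¹y (w · g^ i) y))
        (trans (cong₂ _·_ (trans (assoc _ _ _) (trans (cong (z ·_) commute) (sym (assoc _ _ _)))) (inv-· z (g^ k)))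
        (trans (sym (assoc _ _ _)) (cong (_· inv z) (xyy⁻¹ (z · g^ i) (g^ k)))))))

    double-sym : ∀ {y z} → Double y z → Double z y
    double-sym {y} {z} (k , p) = let (j , eq) = inv-pow ord k in j , subst (_∈ H)
      (trans (inv-· (z · g^ k) (inv y)) (trans (cong₂ _·_ (inv-inv y) (trans (inv-· z (g^ k)) (cong (_· inv z) eq))) (sym (assoc _ _ _)))) (inv∈H p)

    s-double : ∀ {y z} → Double y z → s y ≡ s z
    s-double {y} {z} D = ℕₚ.*-cancelʳ-≡ (s y) (s z) (d z) {{ℕ.≢-nonZero (Period.period≢0 (fixes-period z))}}
      (trans (cong (s y ℕ.*_) d≡) (trans (sym (n≡s*d y)) (n≡s*d z)))
      where
      d∣d : ∀ {y z} → Double y z → d z ∣ d y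
      d∣d {y} {z} D = Period.∣-intro (fixes-period z) (fixes-double (d y) D (Period.∣-elim (fixes-period y) ℕ∣.∣-refl))
      d≡ : d z ≡ d y
      d≡ = ℕ∣.∣-antisym (d∣d D) (d∣d (double-sym D))

    -- In each double coset HxC, put the whole quotient (φ x − T)/s x on the single coset H·rep x, C = ⟨g⟩.
    divisible⇒norm : ∀ (φ : IndFun G) → HInv φ → (∀ i x → φ (x · g^ i) ≡ φ x) → ∀ T (q : El G → ℤ) →
      (∀ x → φ x ≡ T + + s x * q x) → ∃ λ b → HInv b × ∀ x → φ x ≡ T + norm n b x
    divisible⇒norm φ inv-φ φ-g T q φ≡ = b , inv-b , λ x → begin
        φ x                         ≡⟨ sym (double-invariant inv-φ φ-g (rep-double x)) ⟩
        φ (rep x)                   ≡⟨ φ≡ (rep x) ⟩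
        T + + s (rep x) * q (rep x) ≡⟨ cong (λ k → T + + k * q (rep x)) (sym (s-double (rep-double x))) ⟩
        T + + s x * q (rep x)       ≡⟨ cong (λ k → T + + s x * k) (sym (orbit-sum x)) ⟩
        T + + s x * norm (d x) b x  ≡⟨ cong (_+_ T) (sym (∑<-periodic (s x) (d x) (λ i → b (x · g^ i))
              (λ i → return inv-b x (d x) i (Period.∣-elim (fixes-period x) ℕ∣.∣-refl)))) ⟩
        T + norm (s x ℕ.* d x) b x  ≡⟨ cong (λ k → T + norm k b x) (sym (n≡s*d x)) ⟩
        T + norm n b x              ∎
      where
      open ≡-Reasoning
      special? : ∀ y → Dec (y · inv (rep y) ∈ H)
      special? y = (y · inv (rep y)) ∈? H
      b : IndFun G
      b y = ⟦ special? y ⟧ * q (rep y)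
      inv-b : HInv b
      inv-b h y h∈ = ⟦⟧*-cong (special? (h · y)) (special? y)
        (λ p → ·∈H⁻ h∈ (subst (_∈ H) shift p)) (λ p → subst (_∈ H) (sym shift) (·∈H h∈ p)) (λ _ → cong q (rep-H h y h∈))
        where
        shift : (h · y) · inv (rep (h · y)) ≡ h · (y · inv (rep y))
        shift = trans (cong (λ r → (h · y) · inv r) (rep-H h y h∈)) (assoc _ _ _)
      -- Exactly one of x, xg, ..., xg^(d x - 1) lies in H · `rep x`: one exists by the choice of
      -- `rep x`, and two such exponents differ by a multiple of `d x`.
      orbit-sum : ∀ x → norm (d x) b x ≡ q (rep x)
      orbit-sum x = trans (∑<-single (d x) (λ i → b (x · g^ i)) i₀ (m%n<n j (d x)) others)
        (trans (cong₂ _*_ (⟦⟧-true (special? (x · g^ i₀)) (special⁻ i₀ at-i₀)) (cong q (rep-g^ x i₀))) (ℤₚ.*-identityˡ _))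
        where
        instance _ = ℕ.≢-nonZero (Period.period≢0 (fixes-period x))
        r = rep x
        special⁻ : ∀ i → (x · g^ i) · inv r ∈ H → (x · g^ i) · inv (rep (x · g^ i)) ∈ H
        special⁻ i = subst (λ r → (x · g^ i) · inv r ∈ H) (sym (rep-g^ x i))
        special⁺ : ∀ i → (x · g^ i) · inv (rep (x · g^ i)) ∈ H → (x · g^ i) · inv r ∈ H
        special⁺ i = subst (λ r → (x · g^ i) · inv r ∈ H) (rep-g^ x i)
        D = double-sym (rep-double x)
        j = proj₁ D
        i₀ = j % d x
        at-i₀ : (x · g^ i₀) · inv r ∈ H
        at-i₀ = ·∈H⁻ (Period.∣-elim (fixes-period x) (divides (j / d x) refl)) (subst (_∈ H)
          (trans (cong (λ k → (x · g^ k) · inv r) (trans (m≡m%n+[m/n]*n j (d x)) (ℕₚ.+-comm i₀ _)))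
            (trans (cong (_· inv r) (move x (j / d x ℕ.* d x) i₀)) (assoc _ _ _))) (proj₂ D))
        others : ∀ i → i ℕ.< d x → i ≢ i₀ → b (x · g^ i) ≡ 0ℤ
        others i i<d i≢i₀ = trans (cong (_* q (rep (x · g^ i))) (⟦⟧-false (special? (x · g^ i)) λ p →
            i≢i₀ (≡-mod i<d (m%n<n j (d x)) l (Period.∣-intro (fixes-period x) (together i (special⁺ i p)))
                                               (Period.∣-intro (fixes-period x) (together i₀ at-i₀)))))
            refl
          where
          l = proj₁ (inv-pow ord i₀)
          together : ∀ i → (x · g^ i) · inv r ∈ H → Fixes x (i ℕ.+ l)
          together i p = subst (_∈ H) (trans
              (cong (((x · g^ i) · inv r) ·_) (trans (inv-· (x · g^ i₀) (inv r)) (cong (_· inv (x · g^ i₀)) (inv-inv r))))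
              (trans (sym (assoc _ _ _)) (trans (cong₂ _·_ (xy⁻¹y (x · g^ i) r) (trans (inv-· x (g^ i₀)) (cong (_· inv x) (proj₂ (inv-pow ord i₀)))))
              (trans (sym (assoc _ _ _)) (cong (_· inv x) (trans (assoc _ _ _) (cong (x ·_) (sym (pow-+ g i l)))))))))
            (·∈H p (inv∈H at-i₀))

  -- Splitting a multiple prime to p on a cyclic subgroup

  module _ {p : ℕ} (pp : Prime p) {f : Cochain2 G} (inv-f : IsHInv2 G H f) (coc : IsCocycle2 G f)
           (trivial : ∀ S → 𝒞Hp G H p S → IsCoboundaryOn G H S f) (g : El G) (ord : Order g) where
    private
      open Period ord renaming (period to n)
      open Fixed g ord
      open Cocycle f inv-f coc
      open Orbits g ord

      sval : ∀ x → ∃ λ k → ∃ λ m → s x ≡ p ^ k ℕ.* m × ¬ p ∣ m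
      sval x = valuation pp (s x) (s≢0 x)

      v m′ : El G → ℕ
      v x = proj₁ (sval x)
      m′ x = proj₁ (proj₂ (sval x))

      s≡ : ∀ x → s x ≡ p ^ v x ℕ.* m′ x
      s≡ x = proj₁ (proj₂ (proj₂ (sval x)))

      module Extrema = Data.List.Extrema ℕₚ.≤-totalOrder

      x₀ : El G
      x₀ = Extrema.argmax v e (allFin order)

      v≤v₀ : ∀ x → v x ℕ.≤ v x₀
      v≤v₀ x = All.lookup (Extrema.f[xs]≤f[argmax] e (allFin order)) (∈ₗ.∈-allFin x)

      -- δ = n / p^r, so g^δ generates the subgroup of order p^r; being a multiple of `d x₀`, it
      -- makes g^δ fix the coset H x₀.
      r δ : ℕ
      r = v x₀
      δ = m′ x₀ ℕ.* d x₀

      n≡ : ∀ x → n ≡ p ^ v x ℕ.* (m′ x ℕ.* d x)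
      n≡ x = trans (n≡s*d x) (trans (cong (ℕ._* d x) (s≡ x)) (ℕₚ.*-assoc (p ^ v x) (m′ x) (d x)))

      g′ y : El G
      g′ = g^ δ
      y  = (x₀ · g′) · inv x₀

      y∈H : y ∈ H
      y∈H = Period.∣-elim (fixes-period x₀) (ℕ∣.n∣m*n (m′ x₀))

      pow-y : ∀ i → pow G y i ≡ (x₀ · g^ (i ℕ.* δ)) · inv x₀
      pow-y i = trans (pow-conj x₀ g′ i) (cong (λ u → (x₀ · u) · inv x₀) (pow-pow g δ i))

      δ≢0 : δ ≢ 0
      δ≢0 eq = period≢0 (trans (n≡ x₀) (trans (cong (p ^ r ℕ.*_) eq) (ℕₚ.*-zeroʳ (p ^ r))))

      ord-y : Order y
      ord-y = record
        { period   = p ^ r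
        ; period≢0 = p^k≢0 pp r
        ; ∣-intro  = λ {i} eq → ℕ∣.*-cancelʳ-∣ δ {{ℕ.≢-nonZero δ≢0}} (subst (_∣ i ℕ.* δ) (n≡ x₀) (∣-intro (unconj (trans (sym (pow-y i)) eq))))
        ; ∣-elim   = λ {i} dv → trans (pow-y i) (trans (cong (λ u → (x₀ · u) · inv x₀) (∣-elim (subst (_∣ i ℕ.* δ) (sym (n≡ x₀)) (ℕ∣.*-monoˡ-∣ δ dv))))
                       (trans (cong (_· inv x₀) (idʳ x₀)) (invʳ x₀)))
        }
        where
        unconj : ∀ {u} → (x₀ · u) · inv x₀ ≡ e → u ≡ e
        unconj {u} eq = ·-cancelˡ x₀ u e (trans (·-cancelʳ (inv x₀) (x₀ · u) x₀ (trans eq (sym (invʳ x₀)))) (sym (idʳ x₀)))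

      pow-y∈H : ∀ k → pow G y k ∈ H
      pow-y∈H zero    = e∈H
      pow-y∈H (suc k) = ·∈H y∈H (pow-y∈H k)

      trivial-g′ : CoboundaryOn (IsPower g′) f
      trivial-g′ = coboundary-⊆ {f = f} (λ u (k , u≡) → ∈⟪⟫⁺ (isPower? ord-y) (k , trans (cong (λ u → (x₀ · u) · inv x₀) u≡) (sym (pow-conj x₀ g′ k))))
        (fromPrimitive (conjPrimitive x₀ (toPrimitive (generated-subgroup ord-y) inv-f coc
          (trivial (generated ord-y) (generated-cyclic ord-y , ⟨y⟩⊆H , r , ∣generated∣ ord-y)))))
        where
        ⟨y⟩⊆H : generated ord-y ⊆ H
        ⟨y⟩⊆H u∈ = let (k , u≡) = ∈⟪⟫⁻ (isPower? ord-y) u∈ in subst (_∈ H) (sym u≡) (pow-y∈H k)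

      normal-form = coboundary⇒norm (p ^ r) δ (n≡ x₀) trivial-g′
      b = proj₁ normal-form
      inv-b = proj₁ (proj₂ normal-form)
      T = proj₁ (proj₂ (proj₂ normal-form))

      w : El G → ℕ
      w x = proj₁ (ℕₚ.m≤n⇒∃[o]m+o≡n (v≤v₀ x))

      p^r≡ : ∀ x → p ^ r ≡ p ^ v x ℕ.* p ^ w x
      p^r≡ x = trans (cong (p ^_) (sym (proj₂ (ℕₚ.m≤n⇒∃[o]m+o≡n (v≤v₀ x))))) (ℕₚ.^-distribˡ-+-* p (v x) (w x))

      -- Both sides are n / p^(v x). As a multiple of `d x` this exponent fixes H x, so the sum of b
      -- over the p^r powers of g′ consists of p^(v x) equal blocks, each equal to `σ x`.
      period-g′ : ∀ x → p ^ w x ℕ.* δ ≡ m′ x ℕ.* d x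
      period-g′ x = ℕₚ.*-cancelˡ-≡ _ _ (p ^ v x) {{ℕ.≢-nonZero (p^k≢0 pp (v x))}}
        (trans (sym (ℕₚ.*-assoc (p ^ v x) (p ^ w x) δ)) (trans (cong (ℕ._* δ) (sym (p^r≡ x))) (trans (sym (n≡ x₀)) (n≡ x))))

      σ : El G → ℤ
      σ x = ∑< (p ^ w x) (λ i → b (x · pow G g′ i))

      E≡ : ∀ x → E n x ≡ T + + (p ^ v x) * σ x
      E≡ x = trans (proj₂ (proj₂ (proj₂ normal-form)) x) (cong (_+_ T)
        (trans (cong (λ k → ∑< k (λ i → b (x · pow G g′ i))) (p^r≡ x))
               (∑<-periodic (p ^ v x) (p ^ w x) (λ i → b (x · pow G g′ i)) periodic)))
        where
        periodic : ∀ i → b (x · pow G g′ (p ^ w x ℕ.+ i)) ≡ b (x · pow G g′ i)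
        periodic i = trans (cong (λ u → b (x · u)) (trans (pow-pow g δ (p ^ w x ℕ.+ i)) (cong g^_ (ℕₚ.*-distribʳ-+ δ (p ^ w x) i))))
          (trans (return inv-b x (p ^ w x ℕ.* δ) (i ℕ.* δ) (Period.∣-elim (fixes-period x) (divides (m′ x) (period-g′ x))))
                 (cong (λ u → b (x · u)) (sym (pow-pow g δ i))))

    -- The factor m is divisible by `m′ x` for every x. It turns the congruence modulo p^(v x) into
    -- one modulo s x = p^(v x) · m′ x, with the one constant m T for all x, as `divisible⇒norm`
    -- requires.
    coboundary-away-from-p : ∃ λ m → ¬ p ∣ m × CoboundaryOn (IsPower g) (scale G m f)
    coboundary-away-from-p = m , p∤m , Scaled.norm⇒coboundary (proj₁ result) (proj₁ (proj₂ result)) (+ m * T) (proj₂ (proj₂ result))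
      where
      nval = valuation pp n period≢0
      N m : ℕ
      N = proj₁ nval
      m = proj₁ (proj₂ nval)
      p∤m : ¬ p ∣ m
      p∤m = proj₂ (proj₂ (proj₂ nval))
      module Scaled = Cocycle (scale G m f) (scale-HInv {f} m inv-f) (scale-cocycle {f} m coc)
      m′∣m : ∀ x → m′ x ∣ m
      m′∣m x = Coprimality.coprime-divisor (Coprimality.sym (coprime-^ (prime∤⇒coprime pp (proj₂ (proj₂ (proj₂ (sval x))))) N))
        (subst (m′ x ∣_) (proj₁ (proj₂ (proj₂ nval))) (ℕ∣.∣-trans (ℕ∣.m∣m*n (d x)) (subst (m′ x ℕ.* d x ∣_) (sym (n≡ x)) (ℕ∣.n∣m*n (p ^ v x)))))
      t : El G → ℕ
      t x = _∣_.quotient (m′∣m x)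
      scaled≡ : ∀ x → Scaled.E n x ≡ + m * T + + s x * (+ t x * σ x)
      scaled≡ x = trans (∑<-*ˡ n (+ m) (λ j → f (g^ j) g x)) (trans (cong (+ m *_) (E≡ x))
        (trans (ℤₚ.*-distribˡ-+ (+ m) T _) (cong (_+_ (+ m * T)) (begin
          + m * (+ (p ^ v x) * σ x)            ≡⟨ cong (_* (+ (p ^ v x) * σ x)) (trans (cong +_ (_∣_.equality (m′∣m x))) (ℤₚ.pos-* (t x) (m′ x))) ⟩
          (+ t x * + m′ x) * (+ (p ^ v x) * σ x) ≡⟨ lemma (+ t x) (+ m′ x) (+ (p ^ v x)) (σ x) ⟩
          (+ (p ^ v x) * + m′ x) * (+ t x * σ x) ≡⟨ cong (_* (+ t x * σ x)) (sym (trans (cong +_ (s≡ x)) (ℤₚ.pos-* (p ^ v x) (m′ x)))) ⟩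
          + s x * (+ t x * σ x)                ∎))))
        where
        open ≡-Reasoning
        lemma : ∀ t m q s → (t * m) * (q * s) ≡ (q * m) * (t * s)
        lemma = solve-∀
      result = divisible⇒norm (Scaled.E n) (Scaled.E-HInv n) Scaled.E-invariant (+ m * T) (λ x → + t x * σ x) scaled≡

-- Both equivalences, from Sylow transfer and the cyclic case

theorem5p12 : (G : FinGroup) (H : Sub G) → IsSubgroup G H →
    (𝒟 : SetOfSubgroups G) → IsAdmissible G 𝒟 →
    (p : ℕ) → Prime p → (∃ λ m → IsIndex G H m × p ∣ m) →
    ((f : Cochain2 G) → IsPPrimaryCocycle G H p f →
    InSha G H 𝒟 f ⇔ InSha G H (𝒟Hp G 𝒟 H p) f)
    × ((f : Cochain2 G) → IsPPrimaryCocycle G H p f →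
    InSha G H (𝒞 G) f ⇔ InSha G H (𝒞Hp G H p) f)
theorem5p12 G H H≤ 𝒟 (𝒟⇒≤ , 𝒞⊆𝒟 , _) p pp _ =
    (λ f ppc → mk⇔ (λ sha P (S , S∈ , _ , P⊆S , _) → coboundary-⊆ {f = f} (λ _ → P⊆S) (sha S (𝒟H⊆𝒟 S S∈)))
                   (λ sha S S∈ → recover f ppc sha S S∈))
  -- This is not specialised from the first equivalence: `onCyclic` starts directly from vanishing
  -- on `𝒞Hp`.
  , (λ f ppc → mk⇔ (λ sha S (cyclic , _) → sha S cyclic)
                   (λ sha S (g , S⊆⟨g⟩ , _) → coboundary-⊆ {f = f} S⊆⟨g⟩ (onCyclic f ppc sha g)))
  where
  open GroupLemmas G
  open Cochains G H
  open Powers G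
  open CyclicCase G H H≤
  open SylowExistence G

  𝒟H⊆𝒟 : ∀ S → 𝒟H G 𝒟 H S → 𝒟 S
  𝒟H⊆𝒟 S (inj₁ (cyclic , _)) = 𝒞⊆𝒟 S cyclic
  𝒟H⊆𝒟 S (inj₂ (S∈ , _))     = S∈

  ∈full : ∀ x → x ∈ full G
  ∈full x = Vecₚ.lookup⇒[]= x _ (Vecₚ.lookup∘tabulate _ x)

  coprime-to-p : ∀ {P : El G → Set} f → IsPPrimaryCocycle G H p f → ∀ {m} → ¬ p ∣ m →
                 CoboundaryOn P (scale G m f) → CoboundaryOn P f
  coprime-to-p f (_ , _ , k , cob) {m} p∤m = λ cob′ → coboundary-coprime {f = f} {p ^ k} {m} (coprime-^ (prime∤⇒coprime pp p∤m) k)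
    (coboundary-⊆ {f = scale G (p ^ k) f} (λ x _ → ∈full x) cob) cob′

  onCyclic : ∀ f → IsPPrimaryCocycle G H p f → InSha G H (𝒞Hp G H p) f → ∀ g → CoboundaryOn (IsPower g) f
  onCyclic f ppc@(inv-f , coc , _) sha g =
    let (m , p∤m , cob) = coboundary-away-from-p pp inv-f coc sha g (order-of g) in coprime-to-p f ppc p∤m cob

  -- It places the cyclic p-subgroups of H in `𝒟Hp`, each as its own Sylow subgroup, which supplies
  -- the hypothesis of `onCyclic`.
  p-group-sylow : ∀ {S k} → IsSubgroup G S → ∣ S ∣ ≡ p ^ k → IsSylow G p S S
  p-group-sylow {S} {k} S≤ ∣S∣≡ = S≤ , id , k , ∣S∣≡ , ℕ∣.∣-reflexive (sym ∣S∣≡)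
    , λ dv → ¬p^[1+k]∣p^k pp k 1 (λ p∣1 → ¬prime[1] (subst Prime (ℕ∣.∣1⇒≡1 p∣1) pp))
        (subst (p ^ suc k ∣_) (trans ∣S∣≡ (sym (ℕₚ.*-identityʳ (p ^ k)))) dv)

  fromSylow : ∀ {S P} f → IsPPrimaryCocycle G H p f → IsSubgroup G S → IsSylow G p S P →
              IsCoboundaryOn G H P f → IsCoboundaryOn G H S f
  fromSylow f ppc@(inv-f , coc , _) S≤ (P≤ , P⊆S , k , ∣P∣≡ , _ , maximal) cob =
    coprime-to-p f ppc p∤index (fromPrimitive (transfer P≤ S≤ P⊆S (toPrimitive P≤ inv-f coc cob)))
    where
    p∤index : ¬ p ∣ Coset.index P≤ S≤ P⊆S
    p∤index (divides q eq) = maximal (divides q (trans (Coset.lagrange P≤ S≤ P⊆S)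
      (trans (cong₂ ℕ._*_ ∣P∣≡ eq) (trans (ℕₚ.*-comm (p ^ k) (q ℕ.* p)) (ℕₚ.*-assoc q p (p ^ k))))))

  recover : ∀ f → IsPPrimaryCocycle G H p f → InSha G H (𝒟Hp G 𝒟 H p) f → InSha G H 𝒟 f
  recover f ppc@(inv-f , coc , _) sha S S∈ with isCyclic? S
  ... | yes (g , S⊆⟨g⟩ , _) = coboundary-⊆ {f = f} S⊆⟨g⟩ (onCyclic f ppc
          (λ C (cyclic , C⊆H , k , ∣C∣≡) → sha C (C , inj₁ (cyclic , C⊆H) , p-group-sylow {k = k} (𝒟⇒≤ C (𝒞⊆𝒟 C cyclic)) ∣C∣≡)) g)
  ... | no ¬cyclic = let (P , P-sylow) = sylow (𝒟⇒≤ S S∈) pp in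
          fromSylow f ppc (𝒟⇒≤ S S∈) P-sylow (sha P (S , inj₂ (S∈ , ¬cyclic) , P-sylow))
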